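{- Let $n\ge 3$ be odd. A configuration $(\sigma,\tau_s,\tau_{c_i},\rho_{c_i},\rho_{e_{i,j}},x,y_i,z)\in\mathcal{S}_{\text{conf}}$ of the $n\times n\times n$ Rubik's Cube is valid if it satisfies: (1) $\operatorname{sgn}(\sigma)=\operatorname{sgn}(\tau_s)=\operatorname{sgn}(\rho_{c_i})$ for every center corner orbit $i$; (2) $\operatorname{sgn}(\rho_{e_{i,j}})=\operatorname{sgn}(\sigma)\operatorname{sgn}(\tau_i)\operatorname{sgn}(\tau_j)$ for every center edge orbit $(i,j)$, where $\tau_k$ denotes $\tau_{c_k}$ and $\operatorname{sgn}(\tau_{(n+1)/2})$ is interpreted as $1$; (3) $\sum_{k=1}^8 x_k=0$ in $\mathbb{Z}_3$; (4) $\sum_{k=1}^{12} z_k=0$ in $\mathbb{Z}_2$; (5) $y_i=0$ for every coupled edge orbit $i$.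
   Context: Cube and moves: the $n\times n\times n$ Rubik's Cube has faces U, D, F, B, R, L, each an $n\times n$ grid of facelets carrying stickers; in the solved state each face is monochromatic with six distinct colors. For $1\le k\le\lfloor n/2\rfloor$, $F_k,B_k,R_k,L_k,U_k,D_k$ denote clockwise (seen from the named face) $90^\circ$ rotations of the $k$-th slice counted from the named face. A configuration is valid if it is obtained from the solved state by a sequence of these moves. Cubie types ($n$ odd): 8 corners (3 stickers); along each of the 12 edges lie edge cubies at positions $2,\dots,n-1$; the one at position $(n+1)/2$ is a single edge; for $2\le i\le (n-1)/2$ the 24 edge cubies at positions $i$ and $n+1-i$ form coupled edge orbit $i$. On each face index facelets $(r,c)$, $1\le r,c\le n$; for $2\le i\le (n-1)/2$ the center corner orbit $i$ is the 24 facelets with $r,c\in\{i,n+1-i\}$; for $2\le i\le (n-1)/2$, $2\le j\le (n+1)/2$, $j\ne i$, the center edge orbit $(i,j)$ is the 24 facelets occupying on each face the positions $(i,j),(j,n+1-i),(n+1-i,n+1-j),(n+1-j,i)$. $\mathcal{S}_{\text{conf}}$ is the set of arrangements obtained from the solved cube by disassembling and reassembling cubies, each cubie placed in a position of its own orbit (corners among corner positions, single edges among single-edge positions, coupled edges of orbit $i$ within orbit $i$, centers of an orbit within that orbit), corners in any of 3 rotations and edges in either of 2 orientations. Such an arrangement is the tuple: $\sigma\in S_8$ (corner permutation), $\tau_s\in S_{12}$ (single edges), $\tau_{c_i}\in S_{24}$ (coupled edges of orbit $i$), $\rho_{c_i}\in S_{24}$ (center corners of orbit $i$), $\rho_{e_{i,j}}\in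 S_{24}$ (center edges of orbit $(i,j)$), $x\in\mathbb{Z}_3^8$, $y_i\in\mathbb{Z}_2^{24}$, $z\in\mathbb{Z}_2^{12}$ (orientations of corners, coupled edges of orbit $i$, single edges); the solved state has identity permutations and zero orientations. Orientations: a corner has exactly one sticker of the color of the (solved) white or yellow face, a designated pair of opposite faces; its orientation is $0$ if that sticker lies on the white or yellow face, $1$/$2$ if rotated one/two steps clockwise from that. For single edges, one of the two facelets of each single-edge position is a fixed reference facelet (chosen so that the solved state has orientation 0); $z_k=0$ iff the sticker of the cubie at position $k$ that lay on a reference facelet in the solved state lies on a reference facelet. For coupled edges, a coupled-edge facelet on face $X$ along the edge shared with face $Y$ is left-handed if, viewing $X$ from outside with that edge at the top, it lies left of the edge's midpoint; $y_{i,k}=0$ iff the sticker of the cubie at position $k$ of orbit $i$ that lay on a left-handed facelet in the solved state lies on a left-handed facelet. -}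

module Defs where

-- Conventions.  The cube has odd side length n = 2m+3 (m : ℕ),
-- so n ranges over the odd numbers ≥ 3, and H = m+1 = ⌊n/2⌋.
-- Cubies/facelets are described in centred integer coordinates:
-- cubie positions lie in {-H..H}³, a facelet is (position , outward unit normal).
-- Axes: 0 = x (towards R), 1 = y (towards U), 2 = z (towards F);  right-handed.

open import Data.Nat as ℕ using (ℕ; zero; suc)
open import Data.Nat.DivMod using (_mod_)
open import Data.Integer as ℤ using (ℤ; +_; -[1+_]; -_)
open import Data.Fin as Fin using (Fin; zero; suc; toℕ; remQuot)
open import Data.Fin.Permutation using (Permutation′; _⟨$⟩ʳ_)
open import Data.Bool using (Bool; true; false; if_then_else_; _∧_)
open import Data.Product using (_×_; _,_; ∃-syntax)
open import Data.List using (List; []; _∷_)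
open import Relation.Binary.PropositionalEquality using (_≡_; _≢_)
open import Relation.Nullary using (does)

sumFin : ∀ {k} → (Fin k → ℕ) → ℕ
sumFin {zero}  f = 0
sumFin {suc k} f = f zero ℕ.+ sumFin (λ i → f (suc i))

negOnePow : ℕ → ℤ
negOnePow zero    = + 1
negOnePow (suc k) = - negOnePow k

inversions : ∀ {k} → Permutation′ k → ℕ
inversions π = sumFin (λ i → sumFin (λ j →
  if (toℕ i ℕ.<ᵇ toℕ j) ∧ (toℕ (π ⟨$⟩ʳ j) ℕ.<ᵇ toℕ (π ⟨$⟩ʳ i)) then 1 else 0))

sgn : ∀ {k} → Permutation′ k → ℤ
sgn π = negOnePow (inversions π)

_⊕[_]_ : ∀ {k} → Fin k → (l : ℕ) → {{_ : ℕ.NonZero l}} → Fin k → Fin l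
i ⊕[ l ] j = (toℕ i ℕ.+ toℕ j) mod l

record V : Set where
  constructor v3
  field
    vx vy vz : ℤ
open V public

_⊞_ : V → V → V
v3 a b c ⊞ v3 d e f = v3 (a ℤ.+ d) (b ℤ.+ e) (c ℤ.+ f)

_⊙_ : ℤ → V → V
k ⊙ v3 a b c = v3 (k ℤ.* a) (k ℤ.* b) (k ℤ.* c)

dot : V → V → ℤ
dot (v3 a b c) (v3 d e f) = a ℤ.* d ℤ.+ b ℤ.* e ℤ.+ c ℤ.* f

cross : V → V → V
cross (v3 a b c) (v3 d e f) =
  v3 (b ℤ.* f ℤ.- c ℤ.* e) (c ℤ.* d ℤ.- a ℤ.* f) (a ℤ.* e ℤ.- b ℤ.* d)

unit : Fin 3 → V
unit zero             = v3 (+ 1) (+ 0) (+ 0)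
unit (suc zero)       = v3 (+ 0) (+ 1) (+ 0)
unit (suc (suc zero)) = v3 (+ 0) (+ 0) (+ 1)

comp : Fin 3 → V → ℤ
comp zero             v = vx v
comp (suc zero)       v = vy v
comp (suc (suc zero)) v = vz v

nxt : Fin 3 → Fin 3
nxt zero             = suc zero
nxt (suc zero)       = suc (suc zero)
nxt (suc (suc zero)) = zero

sg : Fin 2 → ℤ
sg zero       = + 1
sg (suc zero) = -[1+ 0 ]

isNeg : ℤ → Bool
isNeg (+ _)    = false
isNeg -[1+ _ ] = true

-- rotation by +90° (counterclockwise seen from the tip) about an axis
rotP : Fin 3 → V → V
rotP zero             (v3 a b c) = v3 a (- c) b
rotP (suc zero)       (v3 a b c) = v3 c b (- a)
rotP (suc (suc zero)) (v3 a b c) = v3 (- b) a c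

rotM : Fin 3 → V → V
rotM zero             (v3 a b c) = v3 a c (- b)
rotM (suc zero)       (v3 a b c) = v3 (- c) b a
rotM (suc (suc zero)) (v3 a b c) = v3 b (- a) c

-- a facelet: (cubie position , outward unit normal of the face it lies on)
Facelet : Set
Facelet = V × V

module Cube (m : ℕ) where

  H : ℤ
  H = + suc m

  -- Moves.  A face is (axis , sign); its outward normal is sg s ⊙ unit a
  -- (R,L,U,D,F,B = (x,+),(x,-),(y,+),(y,-),(z,+),(z,-)).
  -- A move (a , s , k) with k : Fin (m+1) is the clockwise (seen from the
  -- face) quarter turn of the (toℕ k + 1)-th slice from that face, i.e. of
  -- all cubies whose a-coordinate is sg s * (H + 1 - (toℕ k + 1)).

  record Move : Set where
    constructor mv
    field
      axis  : Fin 3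
      side  : Fin 2
      slice : Fin (suc m)

  sliceCoord : Move → ℤ
  sliceCoord (mv a s k) = sg s ℤ.* (+ (suc m ℕ.∸ toℕ k))

  -- clockwise seen from the face (a , s): -90° about sg s ⊙ unit a
  turn : Fin 3 → Fin 2 → V → V
  turn a zero       = rotM a
  turn a (suc zero) = rotP a

  applyMove : Move → Facelet → Facelet
  applyMove (mv a s k) (p , d) =
    if does (comp a p ℤ.≟ sliceCoord (mv a s k))
      then (turn a s p , turn a s d)
      else (p , d)

  -- labelled state reached by a move sequence: the sticker which is at
  -- facelet f in the solved state is at facelet (run ms f) afterwards
  run : List Move → Facelet → Facelet
  run []        f = f
  run (x ∷ ms)  f = run ms (applyMove x f)

  -- Corners, Fin 8 ≅ signs of (x , y , z).  cornerF k j, j = 0,1,2, are the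
  -- three facelets of corner position k in clockwise order seen from
  -- outside the cube, starting with the facelet on U or D.

  cornerF : Fin 8 → Fin 3 → Facelet
  cornerF k j with remQuot {2} 4 k
  ... | s₁ , r with remQuot {2} 2 r
  ... | s₂ , s₃ = (p , order (isNeg (sg s₁ ℤ.* sg s₂ ℤ.* sg s₃)) j)
    where
      nX nY nZ p : V
      nX = sg s₁ ⊙ unit zero
      nY = sg s₂ ⊙ unit (suc zero)
      nZ = sg s₃ ⊙ unit (suc (suc zero))
      p  = H ⊙ (nX ⊞ (nY ⊞ nZ))
      order : Bool → Fin 3 → V
      order false zero             = nY
      order false (suc zero)       = nX
      order false (suc (suc zero)) = nZ
      order true  zero             = nY
      order true  (suc zero)       = nZ
      order true  (suc (suc zero)) = nX

  -- Single edges, Fin 12 ≅ (axis a of the edge) × signs of the two other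
  -- coordinates.  singleF k 0 is the reference facelet, singleF k 1 the other.

  singleF : Fin 12 → Fin 2 → Facelet
  singleF k j with remQuot {3} 4 k
  ... | a , r with remQuot {2} 2 r
  ... | s , t = (p , pick j)
    where
      n₁ n₂ p : V
      n₁ = sg s ⊙ unit (nxt a)
      n₂ = sg t ⊙ unit (nxt (nxt a))
      p  = H ⊙ (n₁ ⊞ n₂)
      pick : Fin 2 → V
      pick zero       = n₁
      pick (suc zero) = n₂

  -- Coupled edge orbit i = toℕ o + 2 (o : Fin m, so 2 ≤ i ≤ ⌊n/2⌋), whose
  -- cubies sit at distance d = H + 1 - i = m - toℕ o from the edge midpoint.
  -- Fin 24 ≅ (axis a of the edge) × (side of midpoint) × signs of the two
  -- other coordinates.  coupledF o k 0 is the left-handed facelet of the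
  -- position, coupledF o k 1 the right-handed one.  A facelet (p , nX) on
  -- face X along the edge shared with face Y (normal nY) is left-handed iff
  -- p · (nY × nX) < 0  (nY × nX points to the viewer's right when X is seen
  -- from outside with the common edge on top).

  dist : ∀ {k} → Fin k → ℤ
  dist o = + (m ℕ.∸ toℕ o)

  coupledF : Fin m → Fin 24 → Fin 2 → Facelet
  coupledF o k j with remQuot {3} 8 k
  ... | a , r with remQuot {2} 4 r
  ... | u , r′ with remQuot {2} 2 r′
  ... | s , t = (p , pick (isNeg (dot p (cross n₂ n₁))) j)
    where
      n₁ n₂ p : V
      n₁ = sg s ⊙ unit (nxt a)
      n₂ = sg t ⊙ unit (nxt (nxt a))
      p  = ((sg u ℤ.* dist o) ⊙ unit a) ⊞ (H ⊙ (n₁ ⊞ n₂))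
      -- argument: whether (p , n₁) is left-handed
      pick : Bool → Fin 2 → V
      pick true  zero       = n₁
      pick true  (suc zero) = n₂
      pick false zero       = n₂
      pick false (suc zero) = n₁

  -- Faces, Fin 6 ≅ axis × sign.  On each face, facelet (r , c) (row r from
  -- the top, column c from the left, seen from outside, 1 ≤ r,c ≤ n) is given
  -- by offsets v = r - (H+1) (downwards) and u = c - (H+1) (rightwards).

  normal : Fin 6 → V
  normal f with remQuot {3} 2 f
  ... | a , s = sg s ⊙ unit a

  upV : Fin 6 → V
  upV f with remQuot {3} 2 f
  ... | suc zero , _ = unit (suc (suc zero))
  ... | _        , _ = unit (suc zero)

  faceF : Fin 6 → ℤ → ℤ → Facelet
  faceF f v u =
    ( (H ⊙ normal f) ⊞ ((u ⊙ cross (upV f) (normal f)) ⊞ ((- v) ⊙ upV f))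
    , normal f )

  faceCentre : Fin 6 → Facelet
  faceCentre f = faceF f (+ 0) (+ 0)

  -- centre corner orbit i = toℕ o + 2: facelets with r , c ∈ {i , n+1-i}
  cornerCentreF : Fin m → Fin 24 → Facelet
  cornerCentreF o k with remQuot {6} 4 k
  ... | f , q with remQuot {2} 2 q
  ... | s₁ , s₂ = faceF f (sg s₁ ℤ.* dist o) (sg s₂ ℤ.* dist o)

  -- centre edge orbit (i , j), i = toℕ o + 2, j = toℕ b + 2 (so 2 ≤ j ≤ (n+1)/2):
  -- on each face the facelets (i,j), (j,n+1-i), (n+1-i,n+1-j), (n+1-j,i)
  edgeCentreF : Fin m → Fin (suc m) → Fin 24 → Facelet
  edgeCentreF o b k with remQuot {6} 4 k
  ... | f , q = pos q
    where
      d e : ℤ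
      d = dist o
      e = dist b
      pos : Fin 4 → Facelet
      pos zero                   = faceF f (- d) (- e)
      pos (suc zero)             = faceF f (- e) d
      pos (suc (suc zero))       = faceF f d e
      pos (suc (suc (suc zero))) = faceF f e (- d)

  -- Elements of S_conf: the tuple (σ, τ_s, τ_{c_i}, ρ_{c_i}, ρ_{e_{i,j}}, x, y_i, z).
  -- Orbit indices: i = toℕ o + 2 with o : Fin m; j = toℕ b + 2 with b : Fin (m+1).

  record Conf : Set where
    field
      σ  : Permutation′ 8
      τs : Permutation′ 12
      τc : Fin m → Permutation′ 24
      ρc : Fin m → Permutation′ 24
      ρe : (o : Fin m) (b : Fin (suc m)) → toℕ b ≢ toℕ o → Permutation′ 24
      x  : Fin 8 → Fin 3
      y  : Fin m → Fin 24 → Fin 2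
      z  : Fin 12 → Fin 2

  -- The facelet arrangement s (sticker at facelet f in the solved state is
  -- at facelet s f) is the reassembly described by the tuple c:
  -- the cubie with home position k is placed at position π k, with the
  -- orientation recorded at that position.
  record Realizes (c : Conf) (st : Facelet → Facelet) : Set where
    open Conf c
    field
      corners  : ∀ k j → st (cornerF k j)
                   ≡ cornerF (σ ⟨$⟩ʳ k) (j ⊕[ 3 ] x (σ ⟨$⟩ʳ k))
      singles  : ∀ k j → st (singleF k j)
                   ≡ singleF (τs ⟨$⟩ʳ k) (j ⊕[ 2 ] z (τs ⟨$⟩ʳ k))
      coupled  : ∀ o k j → st (coupledF o k j)
                   ≡ coupledF o (τc o ⟨$⟩ʳ k) (j ⊕[ 2 ] y o (τc o ⟨$⟩ʳ k))
      cCentres : ∀ o k → st (cornerCentreF o k) ≡ cornerCentreF o (ρc o ⟨$⟩ʳ k)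
      eCentres : ∀ o b (ne : toℕ b ≢ toℕ o) k →
                   st (edgeCentreF o b k) ≡ edgeCentreF o b (ρe o b ne ⟨$⟩ʳ k)
      fCentres : ∀ f → st (faceCentre f) ≡ faceCentre f

  Valid : Conf → Set
  Valid c = ∃[ ms ] Realizes c (run ms)

  -- sgn τ_j for j = toℕ b + 2, with sgn τ_{(n+1)/2} := 1
  sgnτ : Conf → Fin (suc m) → ℤ
  sgnτ c b with toℕ b ℕ.<? m
  ... | Relation.Nullary.yes p = sgn (Conf.τc c (Fin.fromℕ< p))
  ... | Relation.Nullary.no  _ = + 1

  Cond1 : Conf → Set
  Cond1 c = sgn σ ≡ sgn τs × (∀ o → sgn (ρc o) ≡ sgn σ)
    where open Conf c

  Cond2 : Conf → Set
  Cond2 c = ∀ (o : Fin m) (b : Fin (suc m)) (ne : toℕ b ≢ toℕ o) →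
            sgn (ρe o b ne) ≡ sgn σ ℤ.* sgn (τc o) ℤ.* sgnτ c b
    where open Conf c

  Cond3 : Conf → Set
  Cond3 c = sumFin (λ k → toℕ (Conf.x c k)) mod 3 ≡ zero

  Cond4 : Conf → Set
  Cond4 c = sumFin (λ k → toℕ (Conf.z c k)) mod 2 ≡ zero

  Cond5 : Conf → Set
  Cond5 c = ∀ (o : Fin m) (k : Fin 24) → Conf.y c o k ≡ zero

{-# OPTIONS --safe #-}

-- Every facelet orbit is the orbit of a facelet at (H , β , γ) with normal e_x
-- under the 24 rotations of the cube: corners (H , H), single edges (H , 0),
-- the two stickers of a coupled edge (H , d) and (d , H), centre corners
-- (d , d), centre edges (d , e).  A turn of the slice at distance c from the
-- centre acts on an orbit through nothing but the knowledge of which of H, β, γ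
-- equal c, so that the action of a fixed word on all cubes is a finite
-- computation.
--
-- First one makes the signs right: a word that is odd on corners and single
-- edges if σ is odd, and one turn of slice i for every odd τ_{c_i}.  By
-- conditions (1) and (2) the permutation still to be made is then even on every
-- orbit, and stays so under words containing an even number of turns of each
-- slice.  Even permutations are products of 3-cycles (j j+1 j+2), realised by
-- conjugates of commutators, and the orbits are settled in an order such that
-- the words for an orbit fix those settled before: corners and single edges
-- (with twists of two corners and flips of two edges for (3) and (4)), coupled
-- edges, centre edges on the middle lines, centre corners, other centre edges.
-- The order matters: a word in outer turns moves coupled edges exactly as it
-- moves the stickers of single edges, and a word in outer turns and turns of
-- slice i moves the orbits (i , j) alike for all j ≠ i.
module Submission where

open import Data.Bool using (Bool; true; false; if_then_else_; _∧_)
open import Data.Bool.Properties using (T-≡; ∧-zeroʳ)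
open import Data.Fin as Fin using (Fin; zero; suc; toℕ; fromℕ; fromℕ<; inject₁; remQuot; #_)
open import Data.Fin.Induction using (<-weakInduction)
open import Data.Fin.Patterns
open import Data.Fin.Permutation using (Permutation′; _⟨$⟩ʳ_; _⟨$⟩ˡ_; _∘ₚ_; inverseˡ; inverseʳ; permutation) renaming (id to idₚ)
open import Data.Fin.Properties using (all?; any?; toℕ<n; toℕ≤pred[n]; toℕ-injective; toℕ-inject₁; toℕ-fromℕ; toℕ-fromℕ<; suc-injective)
open import Data.Integer as ℤ using (ℤ; +_; -[1+_]; -_)
import Data.Integer.Properties as ℤₚ
open import Data.Integer.Tactic.RingSolver using () renaming (solve-∀ to solveℤ-∀)
open import Data.List as List using (List; []; _∷_; _++_; allFin; cartesianProduct; filter)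
import Data.List.Membership.DecPropositional as DecMembership
open import Data.List.Membership.Propositional using (_∈_; _∉_)
open import Data.List.Membership.Propositional.Properties using (∈-allFin; ∈-cartesianProduct⁺; ∈-filter⁺; ∈-filter⁻)
open import Data.List.Relation.Unary.Any using (here; there)
open import Data.Maybe as Maybe using (Maybe; just; nothing; fromMaybe)
open import Data.Nat as ℕ using (ℕ; zero; suc; _≤_; _<_; z≤n)
open import Data.Nat.DivMod using (_%_; _mod_; m%n<n; m%n%n≡m%n; %-distribˡ-+; m<n⇒m%n≡m; [m+kn]%n≡m%n)
import Data.Nat.Properties as ℕₚ
open import Data.Nat.Tactic.RingSolver using (solve-∀)
open import Data.Product using (_×_; _,_; proj₁; proj₂; ∃-syntax)
open import Data.Product.Properties using (≡-dec)
open import Data.Sum using (_⊎_; inj₁; inj₂)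
open import Data.Vec using (Vec; []; _∷_; lookup; tabulate)
open import Function using (_∘_; id; Injective; mk⇔)
open import Function.Bundles using (Equivalence)
open import Relation.Binary.Definitions using (DecidableEquality; tri<; tri≈; tri>)
open import Relation.Binary.PropositionalEquality using (_≡_; _≢_; _≗_; refl; sym; trans; cong; cong₂; subst; module ≡-Reasoning)
open import Relation.Nullary using (Dec; does; yes; no; ¬_; contradiction)
open import Relation.Nullary.Decidable using (map′; _×-dec_; _→-dec_; ¬?; from-yes; does-⇔; dec-true; dec-false)
open import Defs

-- A quarter turn acts on each orbit by disjoint 4-cycles, so the sign reached on an orbit depends
-- only on parities of numbers of turns: of outer turns for corners, single edges and centre
-- corners, of turns of slice i for the coupled edges i, and of outer, slice i and slice j turns
-- together for the centre edges (i , j). Conditions (1) and (2) therefore say that one choice of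
-- parities, `sgn σ` for the outer layer and `sgn (τc o)` for each inner slice, is right on all
-- orbits simultaneously. Condition (5) has another origin. The stickers of a coupled edge are
-- images of (H , H , d) and (H , d , H) with normal e_x, and no rotation carries one to the other,
-- only a reflection does. Hence a left-handed sticker stays left-handed under every move, the two
-- stickers never mix, and (5) enters only when the result is translated into `Realizes`.

-- Inversions, adjacent transpositions and parity.

Inj : ∀ {k l} → (Fin k → Fin l) → Set
Inj = Injective _≡_ _≡_

adj : ∀ {n} → Fin n → Fin (suc n) → Fin (suc n)
adj zero    zero          = suc zero
adj zero    (suc zero)    = zero
adj zero    (suc (suc k)) = suc (suc k)
adj (suc i) zero          = zero
adj (suc i) (suc k)       = suc (adj i k)

adj-involutive : ∀ {n} (i : Fin n) → adj i ∘ adj i ≗ id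
adj-involutive zero    zero          = refl
adj-involutive zero    (suc zero)    = refl
adj-involutive zero    (suc (suc k)) = refl
adj-involutive (suc i) zero          = refl
adj-involutive (suc i) (suc k)       = cong suc (adj-involutive i k)

adj-injective : ∀ {n} (i : Fin n) → Inj (adj i)
adj-injective i {x} {y} e = trans (sym (adj-involutive i x)) (trans (cong (adj i) e) (adj-involutive i y))

adj-inject₁ : ∀ {n} (i : Fin n) → adj i (inject₁ i) ≡ suc i
adj-inject₁ zero    = refl
adj-inject₁ (suc i) = cong suc (adj-inject₁ i)

adj-suc : ∀ {n} (i : Fin n) → adj i (suc i) ≡ inject₁ i
adj-suc zero    = refl
adj-suc (suc i) = cong suc (adj-suc i)

sumFin-cong : ∀ {k} {f g : Fin k → ℕ} → f ≗ g → sumFin f ≡ sumFin g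
sumFin-cong {zero}  e = refl
sumFin-cong {suc k} e = cong₂ ℕ._+_ (e zero) (sumFin-cong (e ∘ suc))

sumFin-adj : ∀ {n} (f : Fin (suc n) → ℕ) (i : Fin n) → sumFin (f ∘ adj i) ≡ sumFin f
sumFin-adj f zero    = swap (f zero) (f (suc zero)) (sumFin (λ k → f (suc (suc k))))
  where
    swap : ∀ a b c → b ℕ.+ (a ℕ.+ c) ≡ a ℕ.+ (b ℕ.+ c)
    swap = solve-∀
sumFin-adj f (suc i) = cong (f zero ℕ.+_) (sumFin-adj (f ∘ suc) i)

-- Values are natural numbers so that the tail `f ∘ suc` is again an argument of the same kind; at
-- `toℕ ∘ (π ⟨$⟩ʳ_)` this unfolds to `inversions π`.
inv : ∀ {k} → (Fin k → ℕ) → ℕ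
inv f = sumFin (λ i → sumFin (λ j →
  if (toℕ i ℕ.<ᵇ toℕ j) ∧ (f j ℕ.<ᵇ f i) then 1 else 0))

inv-cong : ∀ {k} {f g : Fin k → ℕ} → f ≗ g → inv f ≡ inv g
inv-cong {f = f} {g} e = sumFin-cong λ i → sumFin-cong λ j →
  cong₂ (λ a b → if (toℕ i ℕ.<ᵇ toℕ j) ∧ (a ℕ.<ᵇ b) then 1 else 0) (e j) (e i)

below : ℕ → ∀ {k} → (Fin k → ℕ) → ℕ
below v f = sumFin (λ j → if f j ℕ.<ᵇ v then 1 else 0)

<⇒<ᵇ≡true : ∀ {a b} → a < b → (a ℕ.<ᵇ b) ≡ true
<⇒<ᵇ≡true a<b = Equivalence.to T-≡ (ℕₚ.<⇒<ᵇ a<b)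

<⇒>ᵇ≡false : ∀ {a b} → a < b → (b ℕ.<ᵇ a) ≡ false
<⇒>ᵇ≡false {a} {b} a<b with b ℕ.<ᵇ a in e
... | false = refl
... | true  = contradiction (ℕₚ.<ᵇ⇒< b a (Equivalence.from T-≡ e)) (ℕₚ.<-asym a<b)

-- The swap removes the inversion between the two positions and merely permutes the other pairs. At
-- zero the first two rows trade places and one of them loses a unit; further on, the row of zero
-- keeps its sum by `sumFin-adj`.
inv-descent : ∀ {n} (f : Fin (suc n) → ℕ) (i : Fin n) →
              f (suc i) < f (inject₁ i) → inv f ≡ suc (inv (f ∘ adj i))
inv-descent f zero lt
  rewrite <⇒<ᵇ≡true lt | <⇒>ᵇ≡false lt =
  rearrange (below (f zero) rest) (below (f (suc zero)) rest) (inv rest)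
  where
    rest : Fin _ → ℕ
    rest k = f (suc (suc k))
    rearrange : ∀ a b c → suc a ℕ.+ (b ℕ.+ c) ≡ suc (b ℕ.+ (a ℕ.+ c))
    rearrange = solve-∀
inv-descent f (suc i) lt = begin
  below (f zero) (f ∘ suc) ℕ.+ inv (f ∘ suc)
    ≡⟨ cong₂ ℕ._+_ (sym (sumFin-adj (λ j → if f (suc j) ℕ.<ᵇ f zero then 1 else 0) i))
                   (inv-descent (f ∘ suc) i lt) ⟩
  below (f zero) (f ∘ suc ∘ adj i) ℕ.+ suc (inv (f ∘ suc ∘ adj i))
    ≡⟨ ℕₚ.+-suc (below (f zero) (f ∘ suc ∘ adj i)) _ ⟩
  suc (inv (f ∘ adj (suc i))) ∎
  where open ≡-Reasoning

-- The lower end `c` moves up along with the tail: the upper bound pins the last value, and every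
-- earlier one is squeezed between `c` and the value after it.
increasing⇒shift : ∀ {n} (f : Fin (suc n) → ℕ) c → c ≤ f zero →
                   (∀ i → f (inject₁ i) < f (suc i)) → (∀ i → f i < c ℕ.+ suc n) →
                   ∀ i → f i ≡ c ℕ.+ toℕ i
increasing⇒shift {zero}  f c lo inc hi zero = ℕₚ.≤-antisym
  (ℕ.s≤s⁻¹ (subst (f zero <_) (ℕₚ.+-suc c 0) (hi zero)))
  (subst (_≤ f zero) (sym (ℕₚ.+-identityʳ c)) lo)
increasing⇒shift {suc n} f c lo inc hi = λ where
    zero    → ℕₚ.≤-antisym
      (subst (f zero ≤_) (sym (ℕₚ.+-identityʳ c))
        (ℕ.s≤s⁻¹ (subst (f zero <_) (trans (rest zero) (ℕₚ.+-identityʳ (suc c))) (inc zero))))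
      (subst (_≤ f zero) (sym (ℕₚ.+-identityʳ c)) lo)
    (suc i) → trans (rest i) (sym (ℕₚ.+-suc c (toℕ i)))
  where
    rest : ∀ i → f (suc i) ≡ suc c ℕ.+ toℕ i
    rest = increasing⇒shift (f ∘ suc) (suc c) (ℕₚ.≤-<-trans lo (inc zero)) (inc ∘ suc)
             (λ i → subst (f (suc i) <_) (ℕₚ.+-suc c (suc n)) (hi (suc i)))

-- Bubble sort: every injection of Fin (suc n) into itself is built from the
-- identity by composing with adjacent transpositions.
adj-induction : ∀ {n} (Q : (Fin (suc n) → Fin (suc n)) → Set) →
                (∀ {f g} → f ≗ g → Q f → Q g) → Q id →
                (∀ f i → Inj f → Q f → Q (f ∘ adj i)) →
                ∀ f → Inj f → Q f
adj-induction {n} Q ext base step f f-inj = go (inv (toℕ ∘ f)) f f-inj refl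
  where
    go : ∀ c f → Inj f → inv (toℕ ∘ f) ≡ c → Q f
    go c f f-inj e with any? (λ i → toℕ (f (suc i)) ℕ.<? toℕ (f (inject₁ i)))
    go zero f f-inj e | yes (i , lt) with () ← trans (sym e) (inv-descent (toℕ ∘ f) i lt)
    go (suc c) f f-inj e | yes (i , lt) =
      ext (λ k → cong f (adj-involutive i k))
        (step (f ∘ adj i) i (adj-injective i ∘ f-inj)
          (go c (f ∘ adj i) (adj-injective i ∘ f-inj)
            (ℕₚ.suc-injective (trans (sym (inv-descent (toℕ ∘ f) i lt)) e))))
    go c f f-inj e | no none = ext (λ i → sym (toℕ-injective (f≡id i))) base
      where
        inc : ∀ i → toℕ (f (inject₁ i)) < toℕ (f (suc i))
        inc i with ℕₚ.<-cmp (toℕ (f (inject₁ i))) (toℕ (f (suc i)))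
        ... | tri< lt _ _ = lt
        ... | tri> _ _ gt = contradiction (i , gt) none
        ... | tri≈ _ eq _ =
          contradiction (cong toℕ (f-inj (toℕ-injective eq)))
            (λ q → ℕₚ.1+n≢n (sym (trans (sym (toℕ-inject₁ i)) q)))
        f≡id : ∀ i → toℕ (f i) ≡ toℕ i
        f≡id = increasing⇒shift (toℕ ∘ f) 0 z≤n inc (λ i → toℕ<n (f i))

parity : ∀ {k} → (Fin k → Fin k) → ℤ
parity f = negOnePow (inv (toℕ ∘ f))

parity-cong : ∀ {k} {f g : Fin k → Fin k} → f ≗ g → parity f ≡ parity g
parity-cong e = cong negOnePow (inv-cong (cong toℕ ∘ e))

parity-id : ∀ k → parity {k} id ≡ + 1
parity-id k = cong negOnePow (inv-toℕ k)
  where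
    none : ∀ k (f : Fin k → ℕ) → below 0 f ≡ 0
    none zero    f = refl
    none (suc k) f = none k (f ∘ suc)
    inv-toℕ : ∀ k → inv {k} toℕ ≡ 0
    inv-toℕ zero    = refl
    inv-toℕ (suc k) = cong₂ ℕ._+_ (none k (suc ∘ toℕ)) (inv-toℕ k)

-- At an ascent of `f` the swapped function has a descent, so `inv-descent` applies in one direction
-- or the other.
parity-adj : ∀ {n} (f : Fin (suc n) → Fin (suc n)) (i : Fin n) → Inj f →
             parity (f ∘ adj i) ≡ - parity f
parity-adj f i f-inj with ℕₚ.<-cmp (toℕ (f (inject₁ i))) (toℕ (f (suc i)))
... | tri> _ _ gt = trans (sym (ℤₚ.neg-involutive _))
  (cong (-_ ∘ negOnePow) (sym (inv-descent (toℕ ∘ f) i gt)))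
... | tri≈ _ eq _ =
  contradiction (cong toℕ (f-inj (toℕ-injective eq)))
    (λ q → ℕₚ.1+n≢n (sym (trans (sym (toℕ-inject₁ i)) q)))
... | tri< lt _ _ = trans
  (cong negOnePow (inv-descent (toℕ ∘ f ∘ adj i) i
    (subst (toℕ (f (adj i (suc i))) <_) (cong (toℕ ∘ f) (sym (adj-inject₁ i)))
      (subst (λ k → toℕ (f k) < toℕ (f (suc i))) (sym (adj-suc i)) lt))))
  (cong (-_) (parity-cong (cong f ∘ adj-involutive i)))

-- Induction on `g` along adjacent transpositions, each of which negates both sides.
parity-∘ : ∀ {k} (f g : Fin k → Fin k) → Inj f → Inj g →
           parity (f ∘ g) ≡ parity f ℤ.* parity g
parity-∘ {zero}  f g f-inj g-inj = refl
parity-∘ {suc n} f g f-inj = proj₁ ∘ adj-induction Q ext base step g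
  where
    Q : (Fin (suc n) → Fin (suc n)) → Set
    Q g = parity (f ∘ g) ≡ parity f ℤ.* parity g × Inj g
    ext : ∀ {g h} → g ≗ h → Q g → Q h
    ext e (q , g-inj) =
      trans (parity-cong (cong f ∘ sym ∘ e)) (trans q (cong (parity f ℤ.*_) (parity-cong e))) ,
      λ {x} {y} p → g-inj (trans (e x) (trans p (sym (e y))))
    base : Q id
    base = trans (sym (ℤₚ.*-identityʳ _)) (cong (parity f ℤ.*_) (sym (parity-id (suc n)))) , id
    step : ∀ g i → Inj g → Q g → Q (g ∘ adj i)
    step g i g-inj (q , _) =
      trans (parity-adj (f ∘ g) i (g-inj ∘ f-inj))
        (trans (cong -_ q)
          (trans (ℤₚ.neg-distribʳ-* (parity f) (parity g))
            (cong (parity f ℤ.*_) (sym (parity-adj g i g-inj))))) ,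
      adj-injective i ∘ g-inj

negOnePow-±1 : ∀ k → negOnePow k ≡ + 1 ⊎ negOnePow k ≡ -[1+ 0 ]
negOnePow-±1 zero    = inj₁ refl
negOnePow-±1 (suc k) with negOnePow-±1 k
... | inj₁ e = inj₂ (cong -_ e)
... | inj₂ e = inj₁ (cong -_ e)

negOnePow-square : ∀ k → negOnePow k ℤ.* negOnePow k ≡ + 1
negOnePow-square k with negOnePow-±1 k
... | inj₁ e rewrite e = refl
... | inj₂ e rewrite e = refl

to-injective : ∀ {k} (π : Permutation′ k) → Inj (π ⟨$⟩ʳ_)
to-injective π {x} {y} e =
  trans (sym (inverseˡ π)) (trans (cong (π ⟨$⟩ˡ_) e) (inverseˡ π))

from-injective : ∀ {k} (π : Permutation′ k) → Inj (π ⟨$⟩ˡ_)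
from-injective π {x} {y} e =
  trans (sym (inverseʳ π)) (trans (cong (π ⟨$⟩ʳ_) e) (inverseʳ π))

parity-from : ∀ {k} (π : Permutation′ k) → parity (π ⟨$⟩ˡ_) ≡ sgn π
parity-from {k} π = begin
  parity (π ⟨$⟩ˡ_)                               ≡⟨ ℤₚ.*-identityˡ _ ⟨
  + 1 ℤ.* parity (π ⟨$⟩ˡ_)                       ≡⟨ cong (ℤ._* parity (π ⟨$⟩ˡ_)) (negOnePow-square (inversions π)) ⟨
  (sgn π ℤ.* sgn π) ℤ.* parity (π ⟨$⟩ˡ_)         ≡⟨ ℤₚ.*-assoc (sgn π) (sgn π) _ ⟩
  sgn π ℤ.* (sgn π ℤ.* parity (π ⟨$⟩ˡ_))
    ≡⟨ cong (sgn π ℤ.*_) (parity-∘ (π ⟨$⟩ʳ_) (π ⟨$⟩ˡ_) (to-injective π) (from-injective π)) ⟨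
  sgn π ℤ.* parity (λ i → π ⟨$⟩ʳ (π ⟨$⟩ˡ i))
    ≡⟨ cong (sgn π ℤ.*_) (trans (parity-cong (λ i → inverseʳ π)) (parity-id k)) ⟩
  sgn π ℤ.* + 1                                  ≡⟨ ℤₚ.*-identityʳ _ ⟩
  sgn π ∎
  where open ≡-Reasoning

-- What remains to be done after `π` has been performed in order to reach `τ`.
quotient : ∀ {k} (τ π : Permutation′ k) → Fin k → Fin k
quotient τ π i = τ ⟨$⟩ʳ (π ⟨$⟩ˡ i)

quotient-injective : ∀ {k} (τ π : Permutation′ k) → Inj (quotient τ π)
quotient-injective τ π = from-injective π ∘ to-injective τ

quotient-parity : ∀ {k} (τ π : Permutation′ k) → parity (quotient τ π) ≡ sgn τ ℤ.* sgn π
quotient-parity τ π =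
  trans (parity-∘ (τ ⟨$⟩ʳ_) (π ⟨$⟩ˡ_) (to-injective τ) (from-injective π))
    (cong (sgn τ ℤ.*_) (parity-from π))

quotient-even : ∀ {k} (τ π : Permutation′ k) → sgn τ ≡ sgn π → parity (quotient τ π) ≡ + 1
quotient-even τ π e = trans (quotient-parity τ π)
  (trans (cong (ℤ._* sgn π) e) (negOnePow-square (inversions π)))

quotient-∘ : ∀ {k} (τ π : Permutation′ k) i → quotient τ π (π ⟨$⟩ʳ i) ≡ τ ⟨$⟩ʳ i
quotient-∘ τ π i = cong (τ ⟨$⟩ʳ_) (inverseˡ π)

-- Even permutations from 3-cycles.

cycle : ∀ {n} → Fin (suc n) → Fin (suc (suc (suc n))) → Fin (suc (suc (suc n)))
cycle j = adj (suc j) ∘ adj (inject₁ j)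

-- The square is the inverse 3-cycle, so closure of `P` under composition already supplies inverses.
cycle² : ∀ {n} (j : Fin (suc n)) → cycle j ∘ cycle j ≗ adj (inject₁ j) ∘ adj (suc j)
cycle² zero zero = refl
cycle² zero (suc zero) = refl
cycle² zero (suc (suc zero)) = refl
cycle² zero (suc (suc (suc k))) = refl
cycle² {suc n} (suc j) zero = refl
cycle² {suc n} (suc j) (suc k) = cong suc (cycle² j k)

module Generation {n} (P : (Fin (suc (suc (suc n))) → Fin (suc (suc (suc n)))) → Set)
  (P-cong : ∀ {f g} → f ≗ g → P f → P g) (P-id : P id)
  (P-∘ : ∀ {f g} → P f → P g → P (g ∘ f)) (P-cycle : ∀ j → P (cycle j)) where

  -- Telescoping: `cycle i` after `adj (inject₁ i) ∘ adj zero` cancels the inner swap and leaves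
  -- `adj (suc i) ∘ adj zero`. Modulo products of 3-cycles all adjacent transpositions thus agree.
  adj-pairs : ∀ i → P (adj i ∘ adj zero) × P (adj zero ∘ adj i)
  adj-pairs = <-weakInduction (λ i → P (adj i ∘ adj zero) × P (adj zero ∘ adj i))
    (P-cong (sym ∘ adj-involutive zero) P-id , P-cong (sym ∘ adj-involutive zero) P-id)
    λ i (p , q) →
      P-cong (λ k → cong (adj (suc i)) (adj-involutive (inject₁ i) (adj zero k)))
        (P-∘ p (P-cycle i)) ,
      P-cong (λ k → cong (adj zero) (adj-involutive (inject₁ i) (adj (suc i) k)))
        (P-∘ (P-cong (cycle² i) (P-∘ (P-cycle i) (P-cycle i))) q)

  -- The induction passes through odd functions, which are corrected by the fixed transposition
  -- `adj zero`; a further `adj i` changes between the two cases at the cost of one product from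
  -- `adj-pairs`.
  even⇒P : ∀ f → Inj f → parity f ≡ + 1 → P f
  even⇒P f f-inj = proj₁ (adj-induction Q ext base step f f-inj)
    where
      Q : (Fin (suc (suc (suc n))) → Fin (suc (suc (suc n)))) → Set
      Q f = (parity f ≡ + 1 → P f) × (parity f ≡ -[1+ 0 ] → P (f ∘ adj zero))
      ext : ∀ {f g} → f ≗ g → Q f → Q g
      ext e (p , q) = (λ h → P-cong e (p (trans (parity-cong e) h))) ,
                      (λ h → P-cong (e ∘ adj zero) (q (trans (parity-cong e) h)))
      base : Q id
      base = (λ _ → P-id) ,
             λ h → contradiction (trans (sym h) (parity-id (suc (suc (suc n))))) λ ()
      step : ∀ f i → Inj f → Q f → Q (f ∘ adj i)
      step f i f-inj (p , q) =
        (λ h → P-cong (λ k → cong f (adj-involutive zero (adj i k)))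
                 (P-∘ (proj₂ (adj-pairs i)) (q (negate h)))) ,
        (λ h → P-∘ (proj₁ (adj-pairs i)) (p (negate h)))
        where
          negate : ∀ {s} → parity (f ∘ adj i) ≡ s → parity f ≡ - s
          negate h = trans (sym (ℤₚ.neg-involutive _))
                       (cong -_ (trans (sym (parity-adj f i f-inj)) h))

-- Rotations of the cube and symbolic turns.

flip : Fin 2 → Fin 2
flip 0F = 1F
flip 1F = 0F

infixl 6 _⊻_
_⊻_ : Fin 2 → Fin 2 → Fin 2
0F ⊻ t = t
1F ⊻ t = flip t

-- The rotation taking e_x to an axis vector (axis face) and the open octant of
-- (H , β , γ) to the octant with signs sx, sy, sz; these data determine it.
record Rot : Set where
  constructor rot
  field
    face  : Fin 3
    sx sy sz : Fin 2
open Rot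

_≟ᴿ_ : DecidableEquality Rot
rot f x y z ≟ᴿ rot f′ x′ y′ z′ =
  map′ (λ { (refl , refl , refl , refl) → refl }) (λ { refl → refl , refl , refl , refl })
    ((f Fin.≟ f′) ×-dec (x Fin.≟ x′) ×-dec (y Fin.≟ y′) ×-dec (z Fin.≟ z′))

signAt : Fin 3 → Rot → Fin 2
signAt 0F = sx
signAt 1F = sy
signAt 2F = sz

-- The axis which the quarter turns about axis a exchange with b.
partner : Fin 3 → Fin 3 → Fin 3
partner 0F 0F = 0F
partner 0F 1F = 2F
partner 0F 2F = 1F
partner 1F 0F = 2F
partner 1F 1F = 1F
partner 1F 2F = 0F
partner 2F 0F = 1F
partner 2F 1F = 0F
partner 2F 2F = 2F

-- Side 0 follows `rotM` and side 1 follows `rotP`, as in `turn`.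
turnRot : Fin 3 → Fin 2 → Rot → Rot
turnRot 0F 0F (rot f x y z) = rot (partner 0F f) x z (flip y)
turnRot 1F 0F (rot f x y z) = rot (partner 1F f) (flip z) y x
turnRot 2F 0F (rot f x y z) = rot (partner 2F f) y (flip x) z
turnRot 0F 1F (rot f x y z) = rot (partner 0F f) x (flip z) y
turnRot 1F 1F (rot f x y z) = rot (partner 1F f) z y (flip x)
turnRot 2F 1F (rot f x y z) = rot (partner 2F f) (flip y) x z

-- The difference a - f modulo 3.
offset : Fin 3 → Fin 3 → Fin 3
offset 0F a  = a
offset 1F 0F = 2F
offset 1F 1F = 0F
offset 1F 2F = 1F
offset 2F 0F = 1F
offset 2F 1F = 2F
offset 2F 2F = 0F

slot : Fin 2 → Fin 3 → Fin 3 → Fin 3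
slot 0F f a = offset f a
slot 1F f a = partner 0F (offset f a)

-- Which of H , β , γ (slots 0 , 1 , 2) becomes the coordinate along axis a: β and γ
-- follow H in cyclic order of the axes exactly when the octant is a positive one.
slotAt : Fin 3 → Rot → Fin 3
slotAt a (rot f x y z) = slot (x ⊻ y ⊻ z) f a

-- Slices sit at nonzero signed coordinates: a point lies in the turned slice iff its sign along `a`
-- is `s` and its magnitude there is the depth of the slice, which `hit` decides slot by slot. The
-- sign recorded at a vanishing coordinate is harmless because 0 is never hit.
act : (Fin 3 → Bool) → Fin 3 → Fin 2 → Rot → Rot
act hit a s ρ = if does (signAt a ρ Fin.≟ s) ∧ hit (slotAt a ρ) then turnRot a s ρ else ρ

-- Turns of symbolic layers; layer 0 stands for the outer one.  The class of a
-- distance is the layer at that distance, if any.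
record Turn (p : ℕ) : Set where
  constructor tn
  field
    axis  : Fin 3
    side  : Fin 2
    layer : Fin p

Word : ℕ → Set
Word p = List (Turn p)

hits : ∀ {p} → Fin p → Maybe (Fin p) → Bool
hits ℓ nothing  = false
hits ℓ (just c) = does (c Fin.≟ ℓ)

actWord : ∀ {p} → (Fin 3 → Maybe (Fin p)) → Word p → Rot → Rot
actWord c []             ρ = ρ
actWord c (tn a s ℓ ∷ w) ρ = actWord c w (act (hits ℓ ∘ c) a s ρ)

-- Facelet orbits as tables of rotations.

data Kind : Set where
  corner single coupled cCentre eCentre : Kind

size stickers : Kind → ℕ
size corner = 8
size single = 12
size coupled   = 24
size cCentre = 24
size eCentre   = 24
stickers corner = 3
stickers single = 2
stickers coupled   = 2
stickers cCentre = 1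
stickers eCentre   = 1

triple : ∀ {A : Set} → A → A → A → Fin 3 → A
triple a b c 0F = a
triple a b c 1F = b
triple a b c 2F = c

-- What the three slots carry, given entries for `H`, 0 and the two distances; the entries may be
-- distances, classes, truth values or labels. The stickers of a coupled edge get mirror-image
-- profiles.
profile : ∀ {A : Set} → A → A → A → A → (κ : Kind) → Fin (stickers κ) → Fin 3 → A
profile h o x y corner  j  = triple h h h
profile h o x y single  j  = triple h h o
profile h o x y coupled 0F = triple h h x
profile h o x y coupled 1F = triple h x h
profile h o x y cCentre j  = triple h x x
profile h o x y eCentre j  = triple h x y

octant : Fin 3 → Fin 2 → Fin 2 → Fin 2 → Fin 3 → Rot
octant 0F u s t f = rot f u s t
octant 1F u s t f = rot f t u s
octant 2F u s t f = rot f s t u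

cornerAxis : Fin 2 → Fin 3 → Fin 3
cornerAxis _  0F = 1F
cornerAxis 0F 1F = 0F
cornerAxis 0F 2F = 2F
cornerAxis 1F 1F = 2F
cornerAxis 1F 2F = 0F

cornerRot : Fin 2 → Fin 2 → Fin 2 → Fin 3 → Rot
cornerRot x y z j = rot (cornerAxis (x ⊻ y ⊻ z) j) x y z

-- The coordinate along `a` is 0 and has no sign of its own; the sign there is chosen so that slot
-- 2, which holds the 0, falls on axis `a`.
singleRot : Fin 3 → Fin 2 → Fin 2 → Fin 2 → Rot
singleRot a s t 0F = octant a (s ⊻ t) s t (nxt a)
singleRot a s t 1F = octant a (flip (s ⊻ t)) s t (nxt (nxt a))

-- Here the octant is given, and its orientation together with the profile of sticker `j` forces the
-- face.
coupledRot : Fin 3 → Fin 2 → Fin 2 → Fin 2 → Fin 2 → Rot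
coupledRot a u s t j = octant a u s t (pick (u ⊻ s ⊻ t ⊻ j))
  where
    pick : Fin 2 → Fin 3
    pick 0F = nxt a
    pick 1F = nxt (nxt a)

-- Offsets count downwards and to the right, the latter along `cross (upV f) (normal f)`: hence the
-- flip of `v` and the dependence of the horizontal sign on `s`.
faceRot : Fin 3 → Fin 2 → Fin 2 → Fin 2 → Rot
faceRot 0F s v u = rot 0F s (flip v) (flip s ⊻ u)
faceRot 1F s v u = rot 1F (flip s ⊻ u) s (flip v)
faceRot 2F s v u = rot 2F (s ⊻ u) (flip v) s

-- Signs of the vertical and horizontal offsets of the four facelets of a
-- centre edge orbit on one face.
vSign uSign : Fin 4 → Fin 2
vSign 0F = 1F
vSign 1F = 1F
vSign 2F = 0F
vSign 3F = 0F
uSign 0F = 1F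
uSign 1F = 0F
uSign 2F = 0F
uSign 3F = 1F

edgeRot : Fin 3 → Fin 2 → Fin 4 → Rot
edgeRot a s q = faceRot a s (vSign q) (uSign q)

place : (κ : Kind) → Fin (size κ) → Fin (stickers κ) → Rot
place corner k j with remQuot {2} 4 k
... | s₁ , q with remQuot {2} 2 q
... | s₂ , s₃ = cornerRot s₁ s₂ s₃ j
place single k j with remQuot {3} 4 k
... | a , q with remQuot {2} 2 q
... | s , t = singleRot a s t j
place coupled k j with remQuot {3} 8 k
... | a , q with remQuot {2} 4 q
... | u , q′ with remQuot {2} 2 q′
... | s , t = coupledRot a u s t j
place cCentre k j with remQuot {6} 4 k
... | f , q with remQuot {3} 2 f | remQuot {2} 2 q
... | a , s | s₁ , s₂ = faceRot a s s₁ s₂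
place eCentre k j with remQuot {6} 4 k
... | f , q with remQuot {3} 2 f
... | a , s = edgeRot a s q

classes : ∀ {p} → Maybe (Fin (suc p)) → Maybe (Fin (suc p)) → (κ : Kind) → Fin (stickers κ) → Fin 3 → Maybe (Fin (suc p))
classes = profile (just zero) nothing

module _ {p} (cx cy : Maybe (Fin (suc p))) (κ : Kind) where

  Sends : Word (suc p) → (Fin (size κ) → Fin (stickers κ) → Rot) → Set
  Sends w g = ∀ k j → actWord (classes cx cy κ j) w (place κ k j) ≡ g k j

  sends? : ∀ w g → Dec (Sends w g)
  sends? w g = all? λ k → all? λ j → actWord (classes cx cy κ j) w (place κ k j) ≟ᴿ g k j

  Permutes : Word (suc p) → (Fin (size κ) → Fin (size κ)) → Set
  Permutes w f = Sends w (λ k j → place κ (f k) j)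

  permutes? : ∀ w f → Dec (Permutes w f)
  permutes? w f = sends? w _

-- Words, their inverses and parities.

inverse : ∀ {p} → Word p → Word p
inverse []      = []
inverse (x ∷ w) = inverse w ++ x ∷ x ∷ x ∷ []

conjugate : ∀ {p} → Word p → Word p → Word p
conjugate g w = g ++ w ++ inverse g

commutator : ∀ {p} → Word p → Word p → Word p
commutator g h = g ++ h ++ inverse g ++ inverse h

sign : Bool → ℤ
sign true  = -[1+ 0 ]
sign false = + 1

wordParity : ∀ {p} → Maybe (Fin p) → Word p → ℤ
wordParity c []             = + 1
wordParity c (tn a s ℓ ∷ w) = sign (hits ℓ c) ℤ.* wordParity c w

Balanced : ∀ {p} → Word p → Set
Balanced w = ∀ ℓ → wordParity (just ℓ) w ≡ + 1

balanced? : ∀ {p} (w : Word p) → Dec (Balanced w)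
balanced? w = all? λ ℓ → wordParity (just ℓ) w ℤ.≟ + 1

-- The classes open to a distance of at most m, which is never that of the outer layer, listed by a
-- finite type so that `all?` can run through them.
inner : ∀ {p} → Fin (suc p) → Maybe (Fin (suc p))
inner zero    = nothing
inner (suc i) = just (suc i)

-- Orientations as cyclic shifts.

shift : ∀ {J} → Fin (suc J) → ℕ → Fin (suc J)
shift {J} j t = (toℕ j ℕ.+ t) mod suc J

-- Used with c = J, which is -1 modulo `suc J`: opposite twists of two neighbouring positions.
twist : ∀ {n} → ℕ → Fin n → Fin (suc n) → ℕ
twist c zero    zero          = 1
twist c zero    (suc zero)    = c
twist c zero    (suc (suc _)) = 0
twist c (suc i) zero          = 0
twist c (suc i) (suc k)       = twist c i k

toℕ-shift : ∀ {J} (j : Fin (suc J)) t → toℕ (shift j t) ≡ (toℕ j ℕ.+ t) % suc J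
toℕ-shift {J} j t = toℕ-fromℕ< (m%n<n (toℕ j ℕ.+ t) (suc J))

%-+ : ∀ J a b → (a % suc J ℕ.+ b) % suc J ≡ (a ℕ.+ b) % suc J
%-+ J a b = begin
  (a % suc J ℕ.+ b) % suc J                 ≡⟨ %-distribˡ-+ (a % suc J) b (suc J) ⟩
  (a % suc J % suc J ℕ.+ b % suc J) % suc J ≡⟨ cong (λ c → (c ℕ.+ b % suc J) % suc J) (m%n%n≡m%n a (suc J)) ⟩
  (a % suc J ℕ.+ b % suc J) % suc J         ≡⟨ %-distribˡ-+ a b (suc J) ⟨
  (a ℕ.+ b) % suc J                         ∎
  where open ≡-Reasoning

shift-0 : ∀ {J} (j : Fin (suc J)) → shift j 0 ≡ j
shift-0 {J} j = toℕ-injective (trans (toℕ-shift j 0)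
  (trans (cong (_% suc J) (ℕₚ.+-identityʳ (toℕ j))) (m<n⇒m%n≡m (toℕ<n j))))

shift-+ : ∀ {J} (j : Fin (suc J)) s t → shift (shift j s) t ≡ shift j (s ℕ.+ t)
shift-+ {J} j s t = toℕ-injective (begin
  toℕ (shift (shift j s) t)                    ≡⟨ toℕ-shift (shift j s) t ⟩
  (toℕ (shift j s) ℕ.+ t) % suc J              ≡⟨ cong (λ c → (c ℕ.+ t) % suc J) (toℕ-shift j s) ⟩
  ((toℕ j ℕ.+ s) % suc J ℕ.+ t) % suc J        ≡⟨ %-+ J (toℕ j ℕ.+ s) t ⟩
  (toℕ j ℕ.+ s ℕ.+ t) % suc J                  ≡⟨ cong (_% suc J) (ℕₚ.+-assoc (toℕ j) s t) ⟩
  (toℕ j ℕ.+ (s ℕ.+ t)) % suc J                ≡⟨ toℕ-shift j (s ℕ.+ t) ⟨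
  toℕ (shift j (s ℕ.+ t))                      ∎)
  where open ≡-Reasoning

shift-cong : ∀ {J} (j : Fin (suc J)) {s t} → s % suc J ≡ t % suc J → shift j s ≡ shift j t
shift-cong {J} j {s} {t} e = toℕ-injective (begin
  toℕ (shift j s)                ≡⟨ toℕ-shift j s ⟩
  (toℕ j ℕ.+ s) % suc J          ≡⟨ cong (_% suc J) (ℕₚ.+-comm (toℕ j) s) ⟩
  (s ℕ.+ toℕ j) % suc J          ≡⟨ %-+ J s (toℕ j) ⟨
  (s % suc J ℕ.+ toℕ j) % suc J  ≡⟨ cong (λ c → (c ℕ.+ toℕ j) % suc J) e ⟩
  (t % suc J ℕ.+ toℕ j) % suc J  ≡⟨ %-+ J t (toℕ j) ⟩
  (t ℕ.+ toℕ j) % suc J          ≡⟨ cong (_% suc J) (ℕₚ.+-comm t (toℕ j)) ⟩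
  (toℕ j ℕ.+ t) % suc J          ≡⟨ toℕ-shift j t ⟨
  toℕ (shift j t)                ∎)
  where open ≡-Reasoning

-- Sweeping the total twist towards the last position, where it vanishes.
twists-generate : ∀ J {n} (P : (Fin (suc n) → ℕ) → Set) →
  (∀ {s t} → (∀ k → s k % suc J ≡ t k % suc J) → P s → P t) →
  P (λ _ → 0) → (∀ {s t} → P s → P t → P (λ k → s k ℕ.+ t k)) →
  (∀ i → P (twist J i)) → ∀ t → sumFin t % suc J ≡ 0 → P t
twists-generate J {zero} P P-cong P-0 P-+ P-twist t e =
  P-cong (λ { zero → sym (trans (cong (_% suc J) (sym (ℕₚ.+-identityʳ (t zero)))) e) }) P-0
twists-generate J {suc n} P P-cong P-0 P-+ P-twist t e =
  P-cong agree (P-+ (multiple (t zero)) (twists-generate J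
    (λ s → P (0∷ s))
    (λ h → P-cong (λ { zero → refl ; (suc k) → h k }))
    (P-cong (λ { zero → refl ; (suc k) → refl }) P-0)
    (λ p q → P-cong (λ { zero → refl ; (suc k) → refl }) (P-+ p q))
    (λ i → P-cong (λ { zero → refl ; (suc k) → refl }) (P-twist (suc i)))
    swept (trans (cong (_% suc J) (regroup (t zero) (t (suc zero)) _)) e)))
  where
    0∷_ : (Fin (suc n) → ℕ) → Fin (suc (suc n)) → ℕ
    (0∷ s) zero    = 0
    (0∷ s) (suc k) = s k
    swept : Fin (suc n) → ℕ
    swept zero    = t (suc zero) ℕ.+ t zero
    swept (suc k) = t (suc (suc k))
    regroup : ∀ a b c → b ℕ.+ a ℕ.+ c ≡ a ℕ.+ (b ℕ.+ c)
    regroup = solve-∀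
    multiple : ∀ a → P (λ k → a ℕ.* twist J zero k)
    multiple zero    = P-0
    multiple (suc a) = P-+ (P-twist zero) (multiple a)
    agree : ∀ k → (t zero ℕ.* twist J zero k ℕ.+ (0∷ swept) k) % suc J ≡ t k % suc J
    agree zero = cong (_% suc J) (identity (t zero))
      where
        identity : ∀ a → a ℕ.* 1 ℕ.+ 0 ≡ a
        identity = solve-∀
    agree (suc zero) = trans (cong (_% suc J) (collect (t zero) (t (suc zero)) J))
      ([m+kn]%n≡m%n (t (suc zero)) (t zero) (suc J))
      where
        collect : ∀ a b J → a ℕ.* J ℕ.+ (b ℕ.+ a) ≡ b ℕ.+ a ℕ.* suc J
        collect = solve-∀
    agree (suc (suc k)) = cong (λ c → (c ℕ.+ t (suc (suc k))) % suc J) (ℕₚ.*-zeroʳ (t zero))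

-- Explicit words and their finite checks.

module Words where

  private
    R L U D F B : ∀ {p} → Turn (suc p)
    R = tn 0F 0F 0F
    L = tn 0F 1F 0F
    U = tn 1F 0F 0F
    D = tn 1F 1F 0F
    F = tn 2F 0F 0F
    B = tn 2F 1F 0F

    r l u d f b : ∀ {p} → Turn (suc (suc p))
    r = tn 0F 0F 1F
    l = tn 0F 1F 1F
    u = tn 1F 0F 1F
    d = tn 1F 1F 1F
    f = tn 2F 0F 1F
    b = tn 2F 1F 1F

    r₂ l₂ u₂ f₂ b₂ : Turn 3
    r₂ = tn 0F 0F 2F
    l₂ = tn 0F 1F 2F
    u₂ = tn 1F 0F 2F
    f₂ = tn 2F 0F 2F
    b₂ = tn 2F 1F 2F

    -- Each base word is a 3-cycle (or twists two corners, or flips two single edges)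
    -- on its own orbit, mostly because it is a commutator of two words whose supports
    -- share one cubie; the setups, found by breadth-first search, carry the cubies
    -- j, j+1, j+2 (or i, i+1) to those moved by the base word.
    cornerBase twistBase singleBase flipBase : Word 1
    cornerBase = commutator (R ∷ []) (conjugate (inverse (U ∷ [])) (inverse (L ∷ [])))
    -- The square of `c` affects a single corner of the U layer, which it twists in place; the
    -- commutator leaves that twist and the opposite one on the neighbour which U brings there.
    twistBase  = commutator (c ++ c) (U ∷ [])
      where
        c : Word 1
        c = inverse (R ∷ []) ++ inverse (D ∷ []) ++ R ∷ D ∷ []
    -- The classical 3-cycle of the edges UF, UL, UR: the inverse of R with L amounts to a turn of
    -- the middle layer up to a rotation of the whole cube.
    singleBase = F ∷ F ∷ U ∷ inverse (R ∷ []) ++ L ∷ F ∷ F ∷ R ∷ inverse (L ∷ []) ++ U ∷ F ∷ F ∷ []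
    -- The conjugate runs through the same three edges in the opposite direction, and only flips
    -- survive.
    flipBase   = singleBase ++ conjugate (L ∷ U ∷ F ∷ R ∷ []) singleBase

    coupledBase plusBase cCentreBase : Word 2
    coupledBase  = commutator (r ∷ []) (conjugate (U ∷ []) (R ∷ []))
    -- The squared word turns the centres of U by 180° and fixes everything else that
    -- outer turns move.
    plusBase  = commutator (r ∷ []) (q ++ q)
      where
        q : Word 2
        q = R ∷ L ∷ U ∷ U ∷ inverse (R ∷ []) ++ inverse (L ∷ []) ++ U ∷ []
    cCentreBase = commutator (r ∷ []) (conjugate (U ∷ []) (l ∷ []))

    eCentreBase : Word 3
    eCentreBase = commutator (r₂ ∷ []) (conjugate (U ∷ []) (l ∷ []))

    cornerSetups : Vec (Word 1) 6
    cornerSetups =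
        (U ∷ U ∷ F ∷ R ∷ F ∷ F ∷ [])
      ∷ (F ∷ U ∷ D ∷ R ∷ L ∷ [])
      ∷ (R ∷ D ∷ L ∷ L ∷ B ∷ B ∷ [])
      ∷ (F ∷ R ∷ U ∷ D ∷ B ∷ [])
      ∷ (U ∷ R ∷ R ∷ F ∷ F ∷ F ∷ R ∷ [])
      ∷ (D ∷ F ∷ F ∷ F ∷ R ∷ [])
      ∷ []

    twistSetups : Vec (Word 1) 7
    twistSetups =
        (R ∷ B ∷ U ∷ [])
      ∷ (R ∷ B ∷ [])
      ∷ (R ∷ R ∷ [])
      ∷ (F ∷ B ∷ [])
      ∷ (U ∷ U ∷ [])
      ∷ (U ∷ F ∷ F ∷ [])
      ∷ (L ∷ U ∷ L ∷ U ∷ [])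
      ∷ []

    singleSetups : Vec (Word 1) 10
    singleSetups =
        (U ∷ U ∷ U ∷ F ∷ F ∷ [])
      ∷ (F ∷ D ∷ D ∷ F ∷ U ∷ F ∷ [])
      ∷ (D ∷ R ∷ L ∷ U ∷ R ∷ L ∷ [])
      ∷ (R ∷ D ∷ D ∷ F ∷ F ∷ U ∷ R ∷ [])
      ∷ (B ∷ R ∷ U ∷ F ∷ U ∷ R ∷ [])
      ∷ (B ∷ U ∷ D ∷ F ∷ L ∷ L ∷ [])
      ∷ (L ∷ L ∷ F ∷ B ∷ U ∷ [])
      ∷ (D ∷ D ∷ L ∷ L ∷ F ∷ [])
      ∷ (U ∷ R ∷ R ∷ U ∷ [])
      ∷ (R ∷ R ∷ D ∷ F ∷ F ∷ [])
      ∷ []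

    flipSetups : Vec (Word 1) 11
    flipSetups =
        (U ∷ L ∷ F ∷ [])
      ∷ (U ∷ F ∷ F ∷ [])
      ∷ (F ∷ B ∷ B ∷ U ∷ F ∷ [])
      ∷ (R ∷ B ∷ B ∷ U ∷ [])
      ∷ (R ∷ F ∷ [])
      ∷ (B ∷ U ∷ F ∷ [])
      ∷ (L ∷ B ∷ U ∷ U ∷ [])
      ∷ (L ∷ L ∷ F ∷ [])
      ∷ (U ∷ R ∷ R ∷ [])
      ∷ (R ∷ R ∷ L ∷ F ∷ [])
      ∷ (U ∷ L ∷ L ∷ U ∷ U ∷ [])
      ∷ []

    coupledSetups : Vec (Word 2) 22
    coupledSetups =
        (D ∷ b ∷ b ∷ L ∷ F ∷ [])
      ∷ (r ∷ r ∷ D ∷ R ∷ [])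
      ∷ (U ∷ U ∷ r ∷ r ∷ D ∷ R ∷ [])
      ∷ (U ∷ U ∷ D ∷ b ∷ R ∷ [])
      ∷ (U ∷ F ∷ F ∷ F ∷ U ∷ [])
      ∷ (F ∷ l ∷ U ∷ U ∷ F ∷ [])
      ∷ (D ∷ D ∷ F ∷ r ∷ r ∷ d ∷ [])
      ∷ (D ∷ F ∷ D ∷ R ∷ r ∷ [])
      ∷ (R ∷ F ∷ R ∷ B ∷ [])
      ∷ (F ∷ u ∷ u ∷ F ∷ r ∷ [])
      ∷ (B ∷ l ∷ U ∷ U ∷ [])
      ∷ (L ∷ b ∷ L ∷ L ∷ b ∷ b ∷ U ∷ [])
      ∷ (d ∷ B ∷ r ∷ r ∷ r ∷ [])
      ∷ (d ∷ B ∷ r ∷ r ∷ d ∷ B ∷ [])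
      ∷ (R ∷ R ∷ R ∷ U ∷ d ∷ B ∷ d ∷ [])
      ∷ (R ∷ R ∷ L ∷ L ∷ F ∷ R ∷ B ∷ [])
      ∷ (U ∷ R ∷ U ∷ U ∷ u ∷ F ∷ [])
      ∷ (D ∷ L ∷ r ∷ r ∷ d ∷ [])
      ∷ (L ∷ L ∷ U ∷ b ∷ R ∷ [])
      ∷ (L ∷ L ∷ U ∷ R ∷ [])
      ∷ (U ∷ R ∷ [])
      ∷ (b ∷ U ∷ b ∷ R ∷ B ∷ [])
      ∷ []

    plusSetups : Vec (Word 2) 22
    plusSetups =
        (R ∷ f ∷ f ∷ b ∷ R ∷ f ∷ D ∷ r ∷ U ∷ [])
      ∷ (f ∷ f ∷ b ∷ R ∷ f ∷ D ∷ r ∷ U ∷ [])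
      ∷ (R ∷ L ∷ u ∷ R ∷ R ∷ F ∷ f ∷ b ∷ U ∷ [])
      ∷ (f ∷ L ∷ U ∷ U ∷ D ∷ r ∷ f ∷ U ∷ [])
      ∷ (u ∷ B ∷ d ∷ f ∷ U ∷ l ∷ F ∷ F ∷ r ∷ F ∷ [])
      ∷ (f ∷ L ∷ u ∷ L ∷ u ∷ u ∷ R ∷ F ∷ b ∷ U ∷ [])
      ∷ (L ∷ u ∷ L ∷ u ∷ u ∷ R ∷ F ∷ b ∷ U ∷ [])
      ∷ (L ∷ L ∷ U ∷ U ∷ r ∷ r ∷ r ∷ f ∷ U ∷ [])
      ∷ (U ∷ U ∷ r ∷ r ∷ r ∷ U ∷ [])
      ∷ (U ∷ r ∷ r ∷ r ∷ U ∷ [])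
      ∷ (U ∷ r ∷ U ∷ D ∷ r ∷ r ∷ [])
      ∷ (U ∷ U ∷ r ∷ D ∷ r ∷ U ∷ U ∷ [])
      ∷ (r ∷ D ∷ D ∷ D ∷ r ∷ l ∷ l ∷ [])
      ∷ (r ∷ l ∷ D ∷ D ∷ D ∷ r ∷ l ∷ [])
      ∷ (D ∷ l ∷ D ∷ r ∷ r ∷ F ∷ l ∷ [])
      ∷ (r ∷ F ∷ l ∷ l ∷ U ∷ U ∷ [])
      ∷ (r ∷ F ∷ F ∷ F ∷ l ∷ l ∷ l ∷ [])
      ∷ (r ∷ l ∷ F ∷ F ∷ F ∷ l ∷ l ∷ [])
      ∷ (F ∷ F ∷ B ∷ r ∷ F ∷ l ∷ U ∷ U ∷ [])
      ∷ (F ∷ F ∷ r ∷ l ∷ u ∷ u ∷ F ∷ [])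
      ∷ (l ∷ U ∷ B ∷ r ∷ r ∷ U ∷ l ∷ [])
      ∷ (r ∷ B ∷ B ∷ r ∷ B ∷ r ∷ l ∷ [])
      ∷ []

    cCentreSetups : Vec (Word 2) 22
    cCentreSetups =
        (R ∷ f ∷ R ∷ f ∷ d ∷ f ∷ u ∷ [])
      ∷ (f ∷ D ∷ r ∷ u ∷ u ∷ f ∷ [])
      ∷ (d ∷ r ∷ u ∷ F ∷ u ∷ u ∷ [])
      ∷ (u ∷ u ∷ b ∷ l ∷ d ∷ r ∷ [])
      ∷ (u ∷ b ∷ d ∷ r ∷ [])
      ∷ (u ∷ r ∷ r ∷ b ∷ r ∷ [])
      ∷ (L ∷ U ∷ U ∷ u ∷ d ∷ [])
      ∷ (L ∷ U ∷ b ∷ L ∷ u ∷ d ∷ [])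
      ∷ (U ∷ r ∷ B ∷ r ∷ r ∷ U ∷ U ∷ [])
      ∷ (U ∷ l ∷ F ∷ F ∷ u ∷ u ∷ [])
      ∷ (r ∷ U ∷ B ∷ b ∷ b ∷ r ∷ [])
      ∷ (U ∷ U ∷ r ∷ U ∷ U ∷ l ∷ [])
      ∷ (r ∷ u ∷ l ∷ f ∷ [])
      ∷ (l ∷ f ∷ d ∷ r ∷ d ∷ [])
      ∷ (D ∷ r ∷ u ∷ u ∷ [])
      ∷ (l ∷ l ∷ U ∷ U ∷ [])
      ∷ (l ∷ u ∷ l ∷ f ∷ [])
      ∷ (F ∷ l ∷ u ∷ u ∷ f ∷ f ∷ [])
      ∷ (F ∷ l ∷ U ∷ U ∷ u ∷ u ∷ [])
      ∷ (B ∷ B ∷ r ∷ F ∷ F ∷ r ∷ [])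
      ∷ (d ∷ b ∷ d ∷ r ∷ [])
      ∷ (r ∷ f ∷ r ∷ r ∷ d ∷ [])
      ∷ []

    eCentreSetups : Vec (Word 3) 22
    eCentreSetups =
        (u₂ ∷ u₂ ∷ b₂ ∷ R ∷ U ∷ u₂ ∷ F ∷ [])
      ∷ (R ∷ f ∷ R ∷ f ∷ f ∷ u₂ ∷ F ∷ [])
      ∷ (L ∷ b₂ ∷ R ∷ R ∷ U ∷ u₂ ∷ F ∷ [])
      ∷ (R ∷ R ∷ f ∷ L ∷ u₂ ∷ F ∷ [])
      ∷ (u ∷ B ∷ d ∷ f ∷ [])
      ∷ (d ∷ b ∷ r₂ ∷ u₂ ∷ [])
      ∷ (d ∷ L ∷ L ∷ u₂ ∷ [])
      ∷ (L ∷ L ∷ f₂ ∷ R ∷ u₂ ∷ F ∷ [])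
      ∷ (l ∷ F ∷ F ∷ l₂ ∷ F ∷ u₂ ∷ u₂ ∷ [])
      ∷ (U ∷ r ∷ B ∷ B ∷ l₂ ∷ F ∷ F ∷ [])
      ∷ (U ∷ D ∷ r ∷ F ∷ B ∷ B ∷ [])
      ∷ (D ∷ D ∷ l ∷ r₂ ∷ U ∷ [])
      ∷ (D ∷ r ∷ F ∷ l ∷ r₂ ∷ [])
      ∷ (r ∷ F ∷ l ∷ r₂ ∷ [])
      ∷ (F ∷ F ∷ l ∷ r₂ ∷ [])
      ∷ (F ∷ r ∷ U ∷ l ∷ [])
      ∷ (u ∷ L ∷ u₂ ∷ f ∷ [])
      ∷ (r ∷ U ∷ l ∷ l ∷ [])
      ∷ (B ∷ r₂ ∷ F ∷ F ∷ F ∷ [])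
      ∷ (F ∷ F ∷ r₂ ∷ F ∷ r₂ ∷ [])
      ∷ (d ∷ r₂ ∷ d ∷ r₂ ∷ [])
      ∷ (r ∷ D ∷ d ∷ d ∷ r₂ ∷ [])
      ∷ []

  -- Outside this block only the checked statements are used, and no word is unfolded again.
  abstract
    cornerCycle : Fin 6 → Word 1
    cornerCycle j = conjugate (lookup cornerSetups j) cornerBase

    cornerTwist : Fin 7 → Word 1
    cornerTwist i = conjugate (lookup twistSetups i) twistBase

    singleCycle : Fin 10 → Word 1
    singleCycle j = conjugate (lookup singleSetups j) singleBase

    singleFlip : Fin 11 → Word 1
    singleFlip i = conjugate (lookup flipSetups i) flipBase

    -- A quarter turn flips the four single edges it moves, under the chosen reference
    -- facelets; the flips undo this.
    oddWord : Word 1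
    oddWord = U ∷ singleFlip 0F ++ singleFlip 8F ++ singleFlip 9F

    coupledCycle plusCycle cCentreCycle : Fin 22 → Word 2
    coupledCycle j = conjugate (lookup coupledSetups j) coupledBase
    plusCycle    j = conjugate (lookup plusSetups j) plusBase
    cCentreCycle j = conjugate (lookup cCentreSetups j) cCentreBase

    eCentreCycle : Fin 22 → Word 3
    eCentreCycle j = conjugate (lookup eCentreSetups j) eCentreBase

    oddCorners : Fin 8 → Fin 8
    oddCorners = lookup (4F ∷ 0F ∷ 2F ∷ 3F ∷ 5F ∷ 1F ∷ 6F ∷ 7F ∷ [])

    oddSingles : Fin 12 → Fin 12
    oddSingles = lookup (# 10 ∷ 8F ∷ 2F ∷ 3F ∷ 4F ∷ 5F ∷ 6F ∷ 7F ∷ 0F ∷ 9F ∷ 1F ∷ # 11 ∷ [])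

    oddCorners⁴ : ∀ k → oddCorners (oddCorners (oddCorners (oddCorners k))) ≡ k
    oddCorners⁴ = from-yes (all? λ k → oddCorners (oddCorners (oddCorners (oddCorners k))) Fin.≟ k)

    oddSingles⁴ : ∀ k → oddSingles (oddSingles (oddSingles (oddSingles k))) ≡ k
    oddSingles⁴ = from-yes (all? λ k → oddSingles (oddSingles (oddSingles (oddSingles k))) Fin.≟ k)

    cornerCycle-permutes : ∀ j → Permutes nothing nothing corner (cornerCycle j) (cycle j)
    cornerCycle-permutes = from-yes (all? λ j → permutes? nothing nothing corner (cornerCycle j) (cycle j))

    cornerCycle-single : ∀ j → Permutes nothing nothing single (cornerCycle j) id
    cornerCycle-single = from-yes (all? λ j → permutes? nothing nothing single (cornerCycle j) id)

    cornerCycle-balanced : ∀ j → Balanced (cornerCycle j)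
    cornerCycle-balanced = from-yes (all? λ j → balanced? (cornerCycle j))

    cornerTwist-twists : ∀ i → Sends nothing nothing corner (cornerTwist i) (λ k j → place corner k (shift j (twist 2 i k)))
    cornerTwist-twists = from-yes (all? λ i → sends? nothing nothing corner (cornerTwist i) (λ k j → place corner k (shift j (twist 2 i k))))

    cornerTwist-single : ∀ i → Permutes nothing nothing single (cornerTwist i) id
    cornerTwist-single = from-yes (all? λ i → permutes? nothing nothing single (cornerTwist i) id)

    cornerTwist-balanced : ∀ i → Balanced (cornerTwist i)
    cornerTwist-balanced = from-yes (all? λ i → balanced? (cornerTwist i))

    singleCycle-permutes : ∀ j → Permutes nothing nothing single (singleCycle j) (cycle j)
    singleCycle-permutes = from-yes (all? λ j → permutes? nothing nothing single (singleCycle j) (cycle j))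

    singleCycle-corner : ∀ j → Permutes nothing nothing corner (singleCycle j) id
    singleCycle-corner = from-yes (all? λ j → permutes? nothing nothing corner (singleCycle j) id)

    singleCycle-balanced : ∀ j → Balanced (singleCycle j)
    singleCycle-balanced = from-yes (all? λ j → balanced? (singleCycle j))

    singleFlip-flips : ∀ i → Sends nothing nothing single (singleFlip i) (λ k j → place single k (shift j (twist 1 i k)))
    singleFlip-flips = from-yes (all? λ i → sends? nothing nothing single (singleFlip i) (λ k j → place single k (shift j (twist 1 i k))))

    singleFlip-corner : ∀ i → Permutes nothing nothing corner (singleFlip i) id
    singleFlip-corner = from-yes (all? λ i → permutes? nothing nothing corner (singleFlip i) id)

    singleFlip-balanced : ∀ i → Balanced (singleFlip i)
    singleFlip-balanced = from-yes (all? λ i → balanced? (singleFlip i))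

    oddWord-corner : Permutes nothing nothing corner oddWord oddCorners
    oddWord-corner = from-yes (permutes? nothing nothing corner oddWord oddCorners)

    oddWord-single : Permutes nothing nothing single oddWord oddSingles
    oddWord-single = from-yes (permutes? nothing nothing single oddWord oddSingles)

    coupledCycle-permutes : ∀ j → Permutes (just 1F) nothing coupled (coupledCycle j) (cycle j)
    coupledCycle-permutes = from-yes (all? λ j → permutes? (just 1F) nothing coupled (coupledCycle j) (cycle j))

    coupledCycle-corner : ∀ j → Permutes nothing nothing corner (coupledCycle j) id
    coupledCycle-corner = from-yes (all? λ j → permutes? nothing nothing corner (coupledCycle j) id)

    coupledCycle-single : ∀ j → Permutes nothing nothing single (coupledCycle j) id
    coupledCycle-single = from-yes (all? λ j → permutes? nothing nothing single (coupledCycle j) id)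

    coupledCycle-coupled : ∀ j → Permutes nothing nothing coupled (coupledCycle j) id
    coupledCycle-coupled = from-yes (all? λ j → permutes? nothing nothing coupled (coupledCycle j) id)

    coupledCycle-balanced : ∀ j → Balanced (coupledCycle j)
    coupledCycle-balanced = from-yes (all? λ j → balanced? (coupledCycle j))

    plusCycle-permutes : ∀ j → Permutes (just 1F) nothing eCentre (plusCycle j) (cycle j)
    plusCycle-permutes = from-yes (all? λ j → permutes? (just 1F) nothing eCentre (plusCycle j) (cycle j))

    plusCycle-corner : ∀ j → Permutes nothing nothing corner (plusCycle j) id
    plusCycle-corner = from-yes (all? λ j → permutes? nothing nothing corner (plusCycle j) id)

    plusCycle-single : ∀ j → Permutes nothing nothing single (plusCycle j) id
    plusCycle-single = from-yes (all? λ j → permutes? nothing nothing single (plusCycle j) id)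

    -- Checked for the turned slice as well as for the others, since by now all coupled orbits are
    -- settled, including that of the slice in use.
    plusCycle-coupled : ∀ j i → Permutes (inner i) nothing coupled (plusCycle j) id
    plusCycle-coupled = from-yes (all? λ j → all? λ i → permutes? (inner i) nothing coupled (plusCycle j) id)

    plusCycle-plus : ∀ j → Permutes nothing nothing eCentre (plusCycle j) id
    plusCycle-plus = from-yes (all? λ j → permutes? nothing nothing eCentre (plusCycle j) id)

    plusCycle-balanced : ∀ j → Balanced (plusCycle j)
    plusCycle-balanced = from-yes (all? λ j → balanced? (plusCycle j))

    cCentreCycle-permutes : ∀ j → Permutes (just 1F) nothing cCentre (cCentreCycle j) (cycle j)
    cCentreCycle-permutes = from-yes (all? λ j → permutes? (just 1F) nothing cCentre (cCentreCycle j) (cycle j))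

    cCentreCycle-corner : ∀ j → Permutes nothing nothing corner (cCentreCycle j) id
    cCentreCycle-corner = from-yes (all? λ j → permutes? nothing nothing corner (cCentreCycle j) id)

    cCentreCycle-single : ∀ j → Permutes nothing nothing single (cCentreCycle j) id
    cCentreCycle-single = from-yes (all? λ j → permutes? nothing nothing single (cCentreCycle j) id)

    cCentreCycle-coupled : ∀ j i → Permutes (inner i) nothing coupled (cCentreCycle j) id
    cCentreCycle-coupled = from-yes (all? λ j → all? λ i → permutes? (inner i) nothing coupled (cCentreCycle j) id)

    cCentreCycle-plus : ∀ j i → Permutes (inner i) nothing eCentre (cCentreCycle j) id
    cCentreCycle-plus = from-yes (all? λ j → all? λ i → permutes? (inner i) nothing eCentre (cCentreCycle j) id)

    cCentreCycle-cCentre : ∀ j → Permutes nothing nothing cCentre (cCentreCycle j) id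
    cCentreCycle-cCentre = from-yes (all? λ j → permutes? nothing nothing cCentre (cCentreCycle j) id)

    cCentreCycle-balanced : ∀ j → Balanced (cCentreCycle j)
    cCentreCycle-balanced = from-yes (all? λ j → balanced? (cCentreCycle j))

    eCentreCycle-permutes : ∀ j → Permutes (just 1F) (just 2F) eCentre (eCentreCycle j) (cycle j)
    eCentreCycle-permutes = from-yes (all? λ j → permutes? (just 1F) (just 2F) eCentre (eCentreCycle j) (cycle j))

    eCentreCycle-corner : ∀ j → Permutes nothing nothing corner (eCentreCycle j) id
    eCentreCycle-corner = from-yes (all? λ j → permutes? nothing nothing corner (eCentreCycle j) id)

    eCentreCycle-single : ∀ j → Permutes nothing nothing single (eCentreCycle j) id
    eCentreCycle-single = from-yes (all? λ j → permutes? nothing nothing single (eCentreCycle j) id)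

    eCentreCycle-coupled : ∀ j i → Permutes (inner i) nothing coupled (eCentreCycle j) id
    eCentreCycle-coupled = from-yes (all? λ j → all? λ i → permutes? (inner i) nothing coupled (eCentreCycle j) id)

    eCentreCycle-cCentre : ∀ j i → Permutes (inner i) nothing cCentre (eCentreCycle j) id
    eCentreCycle-cCentre = from-yes (all? λ j → all? λ i → permutes? (inner i) nothing cCentre (eCentreCycle j) id)

    -- The remaining pairs of classes cover all other centre edge orbits at once: the mirror image
    -- (2 , 1) on the same two slices, and also the middle lines, whose class is `nothing` just as
    -- for a slice that is not turned.
    eCentreCycle-eCentre : ∀ j i i′ → ¬ (i ≡ 1F × i′ ≡ 2F) → Permutes (inner i) (inner i′) eCentre (eCentreCycle j) id
    eCentreCycle-eCentre = from-yes (all? λ j → all? λ i → all? λ i′ → ¬? ((i Fin.≟ 1F) ×-dec (i′ Fin.≟ 2F)) →-dec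
      permutes? (inner i) (inner i′) eCentre (eCentreCycle j) id)

    eCentreCycle-balanced : ∀ j → Balanced (eCentreCycle j)
    eCentreCycle-balanced = from-yes (all? λ j → balanced? (eCentreCycle j))

    sliceTurn : Word 2
    sliceTurn = r ∷ []

    sliceTurn-corner : Permutes nothing nothing corner sliceTurn id
    sliceTurn-corner = from-yes (permutes? nothing nothing corner sliceTurn id)

    sliceTurn-single : Permutes nothing nothing single sliceTurn id
    sliceTurn-single = from-yes (permutes? nothing nothing single sliceTurn id)

    sliceTurn-outer : wordParity (just 0F) sliceTurn ≡ + 1
    sliceTurn-outer = refl

    sliceTurn-inner : wordParity (just 1F) sliceTurn ≡ -[1+ 0 ]
    sliceTurn-inner = refl

    oddWord-parity : wordParity (just 0F) oddWord ≡ -[1+ 0 ]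
    oddWord-parity = refl

    oddCorners-parity : parity oddCorners ≡ -[1+ 0 ]
    oddCorners-parity = refl

    oddSingles-parity : parity oddSingles ≡ -[1+ 0 ]
    oddSingles-parity = refl

-- From rotations to facelets in coordinates.

cong₃ : ∀ {A B C D : Set} (f : A → B → C → D) {a a′ b b′ c c′} →
        a ≡ a′ → b ≡ b′ → c ≡ c′ → f a b c ≡ f a′ b′ c′
cong₃ f refl refl refl = refl

_≟ⱽ_ : DecidableEquality V
v3 x y z ≟ⱽ v3 x′ y′ z′ =
  map′ (λ { (refl , refl , refl) → refl }) (λ { refl → refl , refl , refl })
    ((x ℤ.≟ x′) ×-dec (y ℤ.≟ y′) ×-dec (z ℤ.≟ z′))

sg-flip : ∀ s → sg (flip s) ≡ - sg s
sg-flip 0F = refl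
sg-flip 1F = refl

sg-⊻ : ∀ s t → sg (s ⊻ t) ≡ sg s ℤ.* sg t
sg-⊻ 0F 0F = refl
sg-⊻ 0F 1F = refl
sg-⊻ 1F 0F = refl
sg-⊻ 1F 1F = refl

-- The image of the vector `M` under the rotation; for `axial` it is the image of e_x, the outward
-- normal.
pos : (Fin 3 → ℤ) → Rot → V
pos M ρ = v3 (sg (signAt 0F ρ) ℤ.* M (slotAt 0F ρ))
             (sg (signAt 1F ρ) ℤ.* M (slotAt 1F ρ))
             (sg (signAt 2F ρ) ℤ.* M (slotAt 2F ρ))

axial : Fin 3 → ℤ
axial 0F      = + 1
axial (suc _) = + 0

facelet : (Fin 3 → ℕ) → Rot → Facelet
facelet M ρ = pos (+_ ∘ M) ρ , pos axial ρ

-- `partner a` negates differences of axes modulo 3, and the one flipped sign reverses the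
-- orientation of the octant, which negates them again.
slotAt-turnRot : ∀ a s ρ b → slotAt (partner a b) (turnRot a s ρ) ≡ slotAt b ρ
slotAt-turnRot a s (rot f x y z) b = table a s f x y z b
  where
    table : ∀ a s f x y z b →
            slotAt (partner a b) (turnRot a s (rot f x y z)) ≡ slotAt b (rot f x y z)
    table = from-yes (all? λ a → all? λ s → all? λ f → all? λ x → all? λ y → all? λ z → all? λ b →
              slotAt (partner a b) (turnRot a s (rot f x y z)) Fin.≟ slotAt b (rot f x y z))

comp-pos : ∀ M a ρ → comp a (pos M ρ) ≡ sg (signAt a ρ) ℤ.* M (slotAt a ρ)
comp-pos M 0F ρ = refl
comp-pos M 1F ρ = refl
comp-pos M 2F ρ = refl

signed-≡ : ∀ t s x c → (sg t ℤ.* + x ≡ sg s ℤ.* + suc c) → t ≡ s × x ≡ suc c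
signed-≡ 0F 0F x c e = refl , ℤₚ.+-injective (trans (sym (ℤₚ.*-identityˡ _)) (trans e (ℤₚ.*-identityˡ _)))
signed-≡ 0F 1F x c e with () ← trans (sym (ℤₚ.*-identityˡ (+ x))) (trans e (ℤₚ.-1*i≡-i (+ suc c)))
signed-≡ 1F 0F zero c e with () ← e
signed-≡ 1F 0F (suc x) c e with () ← trans (sym (ℤₚ.-1*i≡-i (+ suc x))) (trans e (ℤₚ.*-identityˡ (+ suc c)))
signed-≡ 1F 1F x c e = refl , ℤₚ.+-injective (ℤₚ.neg-injective
  (trans (sym (ℤₚ.-1*i≡-i (+ x))) (trans e (ℤₚ.-1*i≡-i (+ suc c)))))

profile-map : ∀ {A B : Set} (φ : A → B) {h o x y h′ o′ x′ y′} →
              φ h ≡ h′ → φ o ≡ o′ → φ x ≡ x′ → φ y ≡ y′ →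
              ∀ κ j i → φ (profile h o x y κ j i) ≡ profile h′ o′ x′ y′ κ j i
profile-map {A} {B} φ p q r s = λ where
    corner  j  → triple-map p p p
    single  j  → triple-map p p q
    coupled 0F → triple-map p p r
    coupled 1F → triple-map p r p
    cCentre j  → triple-map p r r
    eCentre j  → triple-map p r s
  where
    triple-map : ∀ {a b c a′ b′ c′} → φ a ≡ a′ → φ b ≡ b′ → φ c ≡ c′ →
                 ∀ i → φ (triple a b c i) ≡ triple a′ b′ c′ i
    triple-map p q r 0F = p
    triple-map p q r 1F = q
    triple-map p q r 2F = r

act-cong : ∀ {g h : Fin 3 → Bool} → g ≗ h → ∀ a s ρ → act g a s ρ ≡ act h a s ρ
act-cong e a s ρ = cong (λ c → if does (signAt a ρ Fin.≟ s) ∧ c then turnRot a s ρ else ρ) (e (slotAt a ρ))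

module Semantics (m : ℕ) where
  open Cube m

  turn-pos : ∀ M a s ρ → turn a s (pos M ρ) ≡ pos M (turnRot a s ρ)
  turn-pos M a s ρ = lemma a s
    where
      same : ∀ t {i j} → j ≡ i → sg t ℤ.* M i ≡ sg t ℤ.* M j
      same t refl = refl
      negated : ∀ t {i j} → j ≡ i → - (sg t ℤ.* M i) ≡ sg (flip t) ℤ.* M j
      negated t {i} refl = trans (ℤₚ.neg-distribˡ-* (sg t) (M i)) (cong (ℤ._* M i) (sym (sg-flip t)))
      lemma : ∀ a s → turn a s (pos M ρ) ≡ pos M (turnRot a s ρ)
      lemma 0F 0F = cong₃ v3 (same (sx ρ) (slotAt-turnRot 0F 0F ρ 0F)) (same (sz ρ) (slotAt-turnRot 0F 0F ρ 2F)) (negated (sy ρ) (slotAt-turnRot 0F 0F ρ 1F))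
      lemma 1F 0F = cong₃ v3 (negated (sz ρ) (slotAt-turnRot 1F 0F ρ 2F)) (same (sy ρ) (slotAt-turnRot 1F 0F ρ 1F)) (same (sx ρ) (slotAt-turnRot 1F 0F ρ 0F))
      lemma 2F 0F = cong₃ v3 (same (sy ρ) (slotAt-turnRot 2F 0F ρ 1F)) (negated (sx ρ) (slotAt-turnRot 2F 0F ρ 0F)) (same (sz ρ) (slotAt-turnRot 2F 0F ρ 2F))
      lemma 0F 1F = cong₃ v3 (same (sx ρ) (slotAt-turnRot 0F 1F ρ 0F)) (negated (sz ρ) (slotAt-turnRot 0F 1F ρ 2F)) (same (sy ρ) (slotAt-turnRot 0F 1F ρ 1F))
      lemma 1F 1F = cong₃ v3 (same (sz ρ) (slotAt-turnRot 1F 1F ρ 2F)) (same (sy ρ) (slotAt-turnRot 1F 1F ρ 1F)) (negated (sx ρ) (slotAt-turnRot 1F 1F ρ 0F))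
      lemma 2F 1F = cong₃ v3 (negated (sy ρ) (slotAt-turnRot 2F 1F ρ 1F)) (same (sx ρ) (slotAt-turnRot 2F 1F ρ 0F)) (same (sz ρ) (slotAt-turnRot 2F 1F ρ 2F))

  depth : Fin (suc m) → ℕ
  depth k = suc m ℕ.∸ toℕ k

  depth-suc : ∀ k → ∃[ c ] depth k ≡ suc c
  depth-suc k = m ℕ.∸ toℕ k , ℕₚ.+-∸-assoc 1 (ℕ.s≤s⁻¹ (toℕ<n k))

  does-0≟depth : ∀ k → does (0 ℕ.≟ depth k) ≡ false
  does-0≟depth k with depth-suc k
  ... | c , e rewrite e = refl


  does-comp : ∀ M a s k ρ →
    does (comp a (pos (+_ ∘ M) ρ) ℤ.≟ sliceCoord (mv a s k)) ≡
    does (signAt a ρ Fin.≟ s) ∧ does (M (slotAt a ρ) ℕ.≟ depth k)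
  does-comp M a s k ρ with depth-suc k
  ... | c , e rewrite comp-pos (+_ ∘ M) a ρ | e =
    does-⇔ (mk⇔ (signed-≡ (signAt a ρ) s (M (slotAt a ρ)) c)
                (λ { (p , q) → cong₂ (λ t x → sg t ℤ.* + x) p q }))
      (sg (signAt a ρ) ℤ.* + M (slotAt a ρ) ℤ.≟ sg s ℤ.* + suc c)
      ((signAt a ρ Fin.≟ s) ×-dec (M (slotAt a ρ) ℕ.≟ suc c))

  applyMove-facelet : ∀ M a s k ρ → applyMove (mv a s k) (facelet M ρ) ≡
                      facelet M (act (λ i → does (M i ℕ.≟ depth k)) a s ρ)
  applyMove-facelet M a s k ρ rewrite does-comp M a s k ρ
    with does (signAt a ρ Fin.≟ s) ∧ does (M (slotAt a ρ) ℕ.≟ depth k)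
  ... | true  = cong₂ _,_ (turn-pos (+_ ∘ M) a s ρ) (turn-pos axial a s ρ)
  ... | false = refl

  run-++ : ∀ u v f → run (u ++ v) f ≡ run v (run u f)
  run-++ []      v f = refl
  run-++ (x ∷ u) v f = run-++ u v (applyMove x f)

  orbit : (κ : Kind) → ℕ → ℕ → Fin (size κ) → Fin (stickers κ) → Facelet
  orbit κ x y k j = facelet (profile (suc m) 0 x y κ j) (place κ k j)

  module Concrete {p : ℕ} (layer : Fin (suc p) → Fin (suc m)) where

    concrete : Word (suc p) → List Move
    concrete = List.map λ (tn a s ℓ) → mv a s (layer ℓ)

    -- Every comparison of `x` with the depth of a turned layer comes out as the class predicts; the
    -- action of a word depends on nothing else.
    HasClass : ℕ → Maybe (Fin (suc p)) → Set
    HasClass x c = ∀ ℓ → does (x ℕ.≟ depth (layer ℓ)) ≡ hits ℓ c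

    run-facelet : ∀ M c → (∀ i → HasClass (M i) (c i)) → ∀ w ρ →
                  run (concrete w) (facelet M ρ) ≡ facelet M (actWord c w ρ)
    run-facelet M c h []             ρ = refl
    run-facelet M c h (tn a s ℓ ∷ w) ρ = trans
      (cong (run (concrete w)) (trans (applyMove-facelet M a s (layer ℓ) ρ)
        (cong (facelet M) (act-cong (λ i → h i ℓ) a s ρ))))
      (run-facelet M c h w _)

    run-orbit : ∀ κ x y cx cy → HasClass (suc m) (just zero) → HasClass x cx → HasClass y cy →
                ∀ w g → Sends cx cy κ w g →
                ∀ k j → run (concrete w) (orbit κ x y k j) ≡ facelet (profile (suc m) 0 x y κ j) (g k j)
    run-orbit κ x y cx cy hh hx hy w g sends k j = trans
      (run-facelet M (classes cx cy κ j) (λ i ℓ → trans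
          (profile-map (λ v → does (v ℕ.≟ depth (layer ℓ))) {suc m} {0} {x} {y} (hh ℓ) (does-0≟depth (layer ℓ)) (hx ℓ) (hy ℓ) κ j i)
          (sym (profile-map (hits ℓ) refl refl refl refl κ j i)))
        w (place κ k j))
      (cong (facelet M) (sends k j))
      where
        M : Fin 3 → ℕ
        M = profile (suc m) 0 x y κ j

-- The facelets of the cube identified with images under rotations.

upAxis : Fin 3 → Fin 3
upAxis 0F = 1F
upAxis 1F = 2F
upAxis 2F = 1F

module Facelets (m : ℕ) where
  open Cube m
  open Semantics m

  -- Symbolic names of the magnitudes: which of them stands in which slot is decided by enumeration,
  -- although `m`, `x` and `y` are variables.
  label : (κ : Kind) → Fin (stickers κ) → Fin 3 → Fin 4
  label = profile 0F 1F 2F 3F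

  value : ℕ → ℕ → Fin 4 → ℕ
  value x y 0F = suc m
  value x y 1F = 0
  value x y 2F = x
  value x y 3F = y

  coordinate : ∀ κ j i x y t ℓ {c} → label κ j i ≡ ℓ → c ≡ sg t ℤ.* + value x y ℓ →
               c ≡ sg t ℤ.* + profile (suc m) 0 x y κ j i
  coordinate κ j i x y t _ refl refl =
    cong (λ w → sg t ℤ.* + w) (profile-map (value x y) refl refl refl refl κ j i)

  corner-orbit : ∀ k j → cornerF k j ≡ orbit corner 0 0 k j
  corner-orbit k j = cong₂ _,_
    (cong₃ v3
      (coordinate corner j (slotAt 0F ρ) 0 0 s₁ 0F (allH (slotAt 0F ρ)) (ex H (sg s₁) (sg s₂) (sg s₃)))
      (coordinate corner j (slotAt 1F ρ) 0 0 s₂ 0F (allH (slotAt 1F ρ)) (ey H (sg s₁) (sg s₂) (sg s₃)))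
      (coordinate corner j (slotAt 2F ρ) 0 0 s₃ 0F (allH (slotAt 2F ρ)) (ez H (sg s₁) (sg s₂) (sg s₃))))
    (normals k j)
    where
      s₁ s₂ s₃ : Fin 2
      s₁ = proj₁ (remQuot {2} 4 k)
      s₂ = proj₁ (remQuot {2} 2 (proj₂ (remQuot {2} 4 k)))
      s₃ = proj₂ (remQuot {2} 2 (proj₂ (remQuot {2} 4 k)))
      ρ : Rot
      ρ = cornerRot s₁ s₂ s₃ j
      allH : ∀ i → label corner j i ≡ 0F
      allH 0F = refl
      allH 1F = refl
      allH 2F = refl
      ex : ∀ h a b c → h ℤ.* (a ℤ.* + 1 ℤ.+ (b ℤ.* + 0 ℤ.+ c ℤ.* + 0)) ≡ a ℤ.* h
      ex = solveℤ-∀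
      ey : ∀ h a b c → h ℤ.* (a ℤ.* + 0 ℤ.+ (b ℤ.* + 1 ℤ.+ c ℤ.* + 0)) ≡ b ℤ.* h
      ey = solveℤ-∀
      ez : ∀ h a b c → h ℤ.* (a ℤ.* + 0 ℤ.+ (b ℤ.* + 0 ℤ.+ c ℤ.* + 1)) ≡ c ℤ.* h
      ez = solveℤ-∀
      normals : ∀ k j → proj₂ (cornerF k j) ≡ proj₂ (orbit corner 0 0 k j)
      normals = from-yes (all? λ k → all? λ j → proj₂ (cornerF k j) ≟ⱽ proj₂ (orbit corner 0 0 k j))

  single-orbit : ∀ k j → singleF k j ≡ orbit single 0 0 k j
  single-orbit k j = cong₂ _,_
    (position (proj₁ (remQuot {3} 4 k)) (proj₁ (remQuot {2} 2 (proj₂ (remQuot {3} 4 k))))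
      (proj₂ (remQuot {2} 2 (proj₂ (remQuot {3} 4 k)))) j)
    (normals k j)
    where
      along : ∀ a s t j → label single j (slotAt a (singleRot a s t j)) ≡ 1F
      along = from-yes (all? λ a → all? λ s → all? λ t → all? λ j →
                label single j (slotAt a (singleRot a s t j)) Fin.≟ 1F)
      first : ∀ a s t j → label single j (slotAt (nxt a) (singleRot a s t j)) ≡ 0F
      first = from-yes (all? λ a → all? λ s → all? λ t → all? λ j →
                label single j (slotAt (nxt a) (singleRot a s t j)) Fin.≟ 0F)
      second : ∀ a s t j → label single j (slotAt (nxt (nxt a)) (singleRot a s t j)) ≡ 0F
      second = from-yes (all? λ a → all? λ s → all? λ t → all? λ j →
                label single j (slotAt (nxt (nxt a)) (singleRot a s t j)) Fin.≟ 0F)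
      e₀ : ∀ h w s t → h ℤ.* (s ℤ.* + 0 ℤ.+ t ℤ.* + 0) ≡ w ℤ.* + 0
      e₀ = solveℤ-∀
      e₁ : ∀ h s t → h ℤ.* (s ℤ.* + 1 ℤ.+ t ℤ.* + 0) ≡ s ℤ.* h
      e₁ = solveℤ-∀
      e₂ : ∀ h s t → h ℤ.* (s ℤ.* + 0 ℤ.+ t ℤ.* + 1) ≡ t ℤ.* h
      e₂ = solveℤ-∀
      module _ (a : Fin 3) (s t j : Fin 2) where
        ρ : Rot
        ρ = singleRot a s t j
        c₀ = coordinate single j (slotAt a ρ) 0 0 (signAt a ρ) 1F (along a s t j) (e₀ H (sg (signAt a ρ)) (sg s) (sg t))
        c₁ = coordinate single j (slotAt (nxt a) ρ) 0 0 s 0F (first a s t j) (e₁ H (sg s) (sg t))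
        c₂ = coordinate single j (slotAt (nxt (nxt a)) ρ) 0 0 t 0F (second a s t j) (e₂ H (sg s) (sg t))
      position : ∀ a s t j → H ⊙ ((sg s ⊙ unit (nxt a)) ⊞ (sg t ⊙ unit (nxt (nxt a)))) ≡
                 pos (+_ ∘ profile (suc m) 0 0 0 single j) (singleRot a s t j)
      position 0F s t 0F = cong₃ v3 (c₀ 0F s t 0F) (c₁ 0F s t 0F) (c₂ 0F s t 0F)
      position 0F s t 1F = cong₃ v3 (c₀ 0F s t 1F) (c₁ 0F s t 1F) (c₂ 0F s t 1F)
      position 1F s t 0F = cong₃ v3 (c₂ 1F s t 0F) (c₀ 1F s t 0F) (c₁ 1F s t 0F)
      position 1F s t 1F = cong₃ v3 (c₂ 1F s t 1F) (c₀ 1F s t 1F) (c₁ 1F s t 1F)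
      position 2F s t 0F = cong₃ v3 (c₁ 2F s t 0F) (c₂ 2F s t 0F) (c₀ 2F s t 0F)
      position 2F s t 1F = cong₃ v3 (c₁ 2F s t 1F) (c₂ 2F s t 1F) (c₀ 2F s t 1F)
      normals : ∀ k j → proj₂ (singleF k j) ≡ proj₂ (orbit single 0 0 k j)
      normals = from-yes (all? λ k → all? λ j → proj₂ (singleF k j) ≟ⱽ proj₂ (orbit single 0 0 k j))

  -- `coupledF` chooses the normal by a triple product, in which the terms with `H` cancel and -(u d
  -- s t) remains. Handedness thus depends on signs alone and agrees with the choice of face in
  -- `coupledRot`.
  coupled-orbit : ∀ o k j → coupledF o k j ≡ orbit coupled (m ℕ.∸ toℕ o) 0 k j
  coupled-orbit o k j = cong₂ _,_ (position a u s t j)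
      (trans (picked j) (trans (cong (λ b → pick b n₁ n₂ j) (handed a u s t)) (normals a u s t j)))
    where
      a : Fin 3
      u s t : Fin 2
      a = proj₁ (remQuot {3} 8 k)
      u = proj₁ (remQuot {2} 4 (proj₂ (remQuot {3} 8 k)))
      s = proj₁ (remQuot {2} 2 (proj₂ (remQuot {2} 4 (proj₂ (remQuot {3} 8 k)))))
      t = proj₂ (remQuot {2} 2 (proj₂ (remQuot {2} 4 (proj₂ (remQuot {3} 8 k)))))
      x = m ℕ.∸ toℕ o
      n₁ n₂ : V
      n₁ = sg s ⊙ unit (nxt a)
      n₂ = sg t ⊙ unit (nxt (nxt a))
      point : Fin 3 → Fin 2 → Fin 2 → Fin 2 → V
      point a u s t = ((sg u ℤ.* + x) ⊙ unit a) ⊞ (H ⊙ ((sg s ⊙ unit (nxt a)) ⊞ (sg t ⊙ unit (nxt (nxt a)))))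
      along : ∀ a u s t j → label coupled j (slotAt a (coupledRot a u s t j)) ≡ 2F
      along = from-yes (all? λ a → all? λ u → all? λ s → all? λ t → all? λ j →
                label coupled j (slotAt a (coupledRot a u s t j)) Fin.≟ 2F)
      first : ∀ a u s t j → label coupled j (slotAt (nxt a) (coupledRot a u s t j)) ≡ 0F
      first = from-yes (all? λ a → all? λ u → all? λ s → all? λ t → all? λ j →
                label coupled j (slotAt (nxt a) (coupledRot a u s t j)) Fin.≟ 0F)
      second : ∀ a u s t j → label coupled j (slotAt (nxt (nxt a)) (coupledRot a u s t j)) ≡ 0F
      second = from-yes (all? λ a → all? λ u → all? λ s → all? λ t → all? λ j →
                label coupled j (slotAt (nxt (nxt a)) (coupledRot a u s t j)) Fin.≟ 0F)
      e₀ : ∀ h d s t → d ℤ.* + 1 ℤ.+ h ℤ.* (s ℤ.* + 0 ℤ.+ t ℤ.* + 0) ≡ d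
      e₀ = solveℤ-∀
      e₁ : ∀ h d s t → d ℤ.* + 0 ℤ.+ h ℤ.* (s ℤ.* + 1 ℤ.+ t ℤ.* + 0) ≡ s ℤ.* h
      e₁ = solveℤ-∀
      e₂ : ∀ h d s t → d ℤ.* + 0 ℤ.+ h ℤ.* (s ℤ.* + 0 ℤ.+ t ℤ.* + 1) ≡ t ℤ.* h
      e₂ = solveℤ-∀
      module _ (a : Fin 3) (u s t j : Fin 2) where
        ρ : Rot
        ρ = coupledRot a u s t j
        c₀ = coordinate coupled j (slotAt a ρ) x 0 u 2F (along a u s t j) (e₀ H (sg u ℤ.* + x) (sg s) (sg t))
        c₁ = coordinate coupled j (slotAt (nxt a) ρ) x 0 s 0F (first a u s t j) (e₁ H (sg u ℤ.* + x) (sg s) (sg t))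
        c₂ = coordinate coupled j (slotAt (nxt (nxt a)) ρ) x 0 t 0F (second a u s t j) (e₂ H (sg u ℤ.* + x) (sg s) (sg t))
      position : ∀ a u s t j → point a u s t ≡ pos (+_ ∘ profile (suc m) 0 x 0 coupled j) (coupledRot a u s t j)
      position 0F u s t j = cong₃ v3 (c₀ 0F u s t j) (c₁ 0F u s t j) (c₂ 0F u s t j)
      position 1F u s t j = cong₃ v3 (c₂ 1F u s t j) (c₀ 1F u s t j) (c₁ 1F u s t j)
      position 2F u s t j = cong₃ v3 (c₁ 2F u s t j) (c₂ 2F u s t j) (c₀ 2F u s t j)
      pick : Bool → V → V → Fin 2 → V
      pick true  n₁ n₂ 0F = n₁
      pick true  n₁ n₂ 1F = n₂
      pick false n₁ n₂ 0F = n₂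
      pick false n₁ n₂ 1F = n₁
      picked : ∀ j → proj₂ (coupledF o k j) ≡ pick (isNeg (dot (point a u s t) (cross n₂ n₁))) n₁ n₂ j
      picked j with isNeg (dot (point a u s t) (cross n₂ n₁))
      picked 0F | true  = refl
      picked 1F | true  = refl
      picked 0F | false = refl
      picked 1F | false = refl
      isNeg-sg : ∀ w → isNeg (sg w ℤ.* + x) ≡ does (w Fin.≟ 1F)
      -- Here d > 0 is essential; at distance 0 there is no handedness.
      isNeg-sg = positive x (ℕₚ.m<n⇒0<n∸m (toℕ<n o))
        where
          positive : ∀ n → 0 ℕ.< n → ∀ w → isNeg (sg w ℤ.* + n) ≡ does (w Fin.≟ 1F)
          positive (suc n) _ 0F = refl
          positive (suc n) _ 1F = refl
      -- The triple products are spelled out as `dot` and `cross` unfold for each edge axis, so that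
      -- the ring solver can treat the signs as variables.
      dot₀ : ∀ h d s t →
        (d ℤ.* + 1 ℤ.+ h ℤ.* (s ℤ.* + 0 ℤ.+ t ℤ.* + 0)) ℤ.* ((t ℤ.* + 0) ℤ.* (s ℤ.* + 0) ℤ.+ - ((t ℤ.* + 1) ℤ.* (s ℤ.* + 1)))
          ℤ.+ (d ℤ.* + 0 ℤ.+ h ℤ.* (s ℤ.* + 1 ℤ.+ t ℤ.* + 0)) ℤ.* ((t ℤ.* + 1) ℤ.* (s ℤ.* + 0) ℤ.+ - ((t ℤ.* + 0) ℤ.* (s ℤ.* + 0)))
          ℤ.+ (d ℤ.* + 0 ℤ.+ h ℤ.* (s ℤ.* + 0 ℤ.+ t ℤ.* + 1)) ℤ.* ((t ℤ.* + 0) ℤ.* (s ℤ.* + 1) ℤ.+ - ((t ℤ.* + 0) ℤ.* (s ℤ.* + 0))) ≡ - (d ℤ.* s ℤ.* t)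
      dot₀ = solveℤ-∀
      dot₁ : ∀ h d s t →
        (d ℤ.* + 0 ℤ.+ h ℤ.* (s ℤ.* + 0 ℤ.+ t ℤ.* + 1)) ℤ.* ((t ℤ.* + 0) ℤ.* (s ℤ.* + 1) ℤ.+ - ((t ℤ.* + 0) ℤ.* (s ℤ.* + 0)))
          ℤ.+ (d ℤ.* + 1 ℤ.+ h ℤ.* (s ℤ.* + 0 ℤ.+ t ℤ.* + 0)) ℤ.* ((t ℤ.* + 0) ℤ.* (s ℤ.* + 0) ℤ.+ - ((t ℤ.* + 1) ℤ.* (s ℤ.* + 1)))
          ℤ.+ (d ℤ.* + 0 ℤ.+ h ℤ.* (s ℤ.* + 1 ℤ.+ t ℤ.* + 0)) ℤ.* ((t ℤ.* + 1) ℤ.* (s ℤ.* + 0) ℤ.+ - ((t ℤ.* + 0) ℤ.* (s ℤ.* + 0))) ≡ - (d ℤ.* s ℤ.* t)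
      dot₁ = solveℤ-∀
      dot₂ : ∀ h d s t →
        (d ℤ.* + 0 ℤ.+ h ℤ.* (s ℤ.* + 1 ℤ.+ t ℤ.* + 0)) ℤ.* ((t ℤ.* + 1) ℤ.* (s ℤ.* + 0) ℤ.+ - ((t ℤ.* + 0) ℤ.* (s ℤ.* + 0)))
          ℤ.+ (d ℤ.* + 0 ℤ.+ h ℤ.* (s ℤ.* + 0 ℤ.+ t ℤ.* + 1)) ℤ.* ((t ℤ.* + 0) ℤ.* (s ℤ.* + 1) ℤ.+ - ((t ℤ.* + 0) ℤ.* (s ℤ.* + 0)))
          ℤ.+ (d ℤ.* + 1 ℤ.+ h ℤ.* (s ℤ.* + 0 ℤ.+ t ℤ.* + 0)) ℤ.* ((t ℤ.* + 0) ℤ.* (s ℤ.* + 0) ℤ.+ - ((t ℤ.* + 1) ℤ.* (s ℤ.* + 1))) ≡ - (d ℤ.* s ℤ.* t)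
      dot₂ = solveℤ-∀
      handed : ∀ a u s t → isNeg (dot (point a u s t) (cross (sg t ⊙ unit (nxt (nxt a))) (sg s ⊙ unit (nxt a)))) ≡
               does (flip (u ⊻ s ⊻ t) Fin.≟ 1F)
      handed a u s t = trans (cong isNeg (trans (dots a) regroup)) (isNeg-sg (flip (u ⊻ s ⊻ t)))
        where
          dots : ∀ a → dot (point a u s t) (cross (sg t ⊙ unit (nxt (nxt a))) (sg s ⊙ unit (nxt a))) ≡
                 - (sg u ℤ.* + x ℤ.* sg s ℤ.* sg t)
          dots 0F = dot₀ H (sg u ℤ.* + x) (sg s) (sg t)
          dots 1F = dot₁ H (sg u ℤ.* + x) (sg s) (sg t)
          dots 2F = dot₂ H (sg u ℤ.* + x) (sg s) (sg t)
          reorder : ∀ u x s t → - (u ℤ.* x ℤ.* s ℤ.* t) ≡ - (u ℤ.* s ℤ.* t) ℤ.* x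
          reorder = solveℤ-∀
          regroup : - (sg u ℤ.* + x ℤ.* sg s ℤ.* sg t) ≡ sg (flip (u ⊻ s ⊻ t)) ℤ.* + x
          regroup = trans (reorder (sg u) (+ x) (sg s) (sg t)) (cong (ℤ._* + x)
            (sym (trans (sg-flip (u ⊻ s ⊻ t)) (cong -_ (trans (sg-⊻ (u ⊻ s) t) (cong (ℤ._* sg t) (sg-⊻ u s)))))))
      normals : ∀ a u s t j →
        pick (does (flip (u ⊻ s ⊻ t) Fin.≟ 1F)) (sg s ⊙ unit (nxt a)) (sg t ⊙ unit (nxt (nxt a))) j ≡
        pos axial (coupledRot a u s t j)
      normals = from-yes (all? λ a → all? λ u → all? λ s → all? λ t → all? λ j →
        pick (does (flip (u ⊻ s ⊻ t) Fin.≟ 1F)) (sg s ⊙ unit (nxt a)) (sg t ⊙ unit (nxt (nxt a))) j ≟ⱽ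
        pos axial (coupledRot a u s t j))

  -- `partner (upAxis a) a` is the third axis, that of the horizontal offset.
  face-position : ∀ f s₁ s₂ v u M → let a = proj₁ (remQuot {3} 2 f) ; ρ = faceRot a (proj₂ (remQuot {3} 2 f)) s₁ s₂ in
    M (slotAt a ρ) ≡ suc m → M (slotAt (upAxis a) ρ) ≡ v → M (slotAt (partner (upAxis a) a) ρ) ≡ u →
    proj₁ (faceF f (sg s₁ ℤ.* + v) (sg s₂ ℤ.* + u)) ≡ pos (+_ ∘ M) ρ
  face-position f s₁ s₂ v u M p q r = lemma f p q r
    where
      along : ∀ t h w w′ n → n ≡ h → + h ℤ.* sg t ℤ.+ (w ℤ.* + 0 ℤ.+ (- w′) ℤ.* + 0) ≡ sg t ℤ.* + n
      along t h w w′ _ refl = e (+ h) (sg t) w w′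
        where
          e : ∀ h t w w′ → h ℤ.* t ℤ.+ (w ℤ.* + 0 ℤ.+ (- w′) ℤ.* + 0) ≡ t ℤ.* h
          e = solveℤ-∀
      upward : ∀ s v h w n → n ≡ v → h ℤ.* + 0 ℤ.+ (w ℤ.* + 0 ℤ.+ (- (sg s ℤ.* + v)) ℤ.* + 1) ≡ sg (flip s) ℤ.* + n
      upward s v h w _ refl = trans (e h w (sg s) (+ v)) (cong (ℤ._* + v) (sym (sg-flip s)))
        where
          e : ∀ h w s v → h ℤ.* + 0 ℤ.+ (w ℤ.* + 0 ℤ.+ (- (s ℤ.* v)) ℤ.* + 1) ≡ - s ℤ.* v
          e = solveℤ-∀
      sideways : ∀ t s u h w n → n ≡ u → h ℤ.* + 0 ℤ.+ ((sg s ℤ.* + u) ℤ.* sg t ℤ.+ (- w) ℤ.* + 0) ≡ sg (t ⊻ s) ℤ.* + n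
      sideways t s u h w _ refl = trans (e h w (sg s) (sg t) (+ u)) (cong (ℤ._* + u) (sym (sg-⊻ t s)))
        where
          e : ∀ h w s t u → h ℤ.* + 0 ℤ.+ ((s ℤ.* u) ℤ.* t ℤ.+ (- w) ℤ.* + 0) ≡ (t ℤ.* s) ℤ.* u
          e = solveℤ-∀
      V₁ U₁ : ℤ
      V₁ = sg s₁ ℤ.* + v
      U₁ = sg s₂ ℤ.* + u
      lemma : ∀ f → let a = proj₁ (remQuot {3} 2 f) ; ρ = faceRot a (proj₂ (remQuot {3} 2 f)) s₁ s₂ in
        M (slotAt a ρ) ≡ suc m → M (slotAt (upAxis a) ρ) ≡ v → M (slotAt (partner (upAxis a) a) ρ) ≡ u →
        proj₁ (faceF f V₁ U₁) ≡ pos (+_ ∘ M) ρ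
      lemma 0F p q r = cong₃ v3 (along 0F (suc m) U₁ V₁ _ p) (upward s₁ v H U₁ _ q) (sideways 1F s₂ u H V₁ _ r)
      lemma 1F p q r = cong₃ v3 (along 1F (suc m) U₁ V₁ _ p) (upward s₁ v H U₁ _ q) (sideways 0F s₂ u H V₁ _ r)
      lemma 2F p q r = cong₃ v3 (sideways 1F s₂ u H V₁ _ r) (along 0F (suc m) U₁ V₁ _ p) (upward s₁ v H U₁ _ q)
      lemma 3F p q r = cong₃ v3 (sideways 0F s₂ u H V₁ _ r) (along 1F (suc m) U₁ V₁ _ p) (upward s₁ v H U₁ _ q)
      lemma 4F p q r = cong₃ v3 (sideways 0F s₂ u H V₁ _ r) (upward s₁ v H U₁ _ q) (along 0F (suc m) U₁ V₁ _ p)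
      lemma 5F p q r = cong₃ v3 (sideways 1F s₂ u H V₁ _ r) (upward s₁ v H U₁ _ q) (along 1F (suc m) U₁ V₁ _ p)

  at-slot : ∀ κ j i x y ℓ → label κ j i ≡ ℓ → profile (suc m) 0 x y κ j i ≡ value x y ℓ
  at-slot κ j i x y _ refl = sym (profile-map (value x y) refl refl refl refl κ j i)

  cCentre-orbit : ∀ o k → cornerCentreF o k ≡ orbit cCentre (m ℕ.∸ toℕ o) 0 k 0F
  cCentre-orbit o k = cong₂ _,_
      (face-position f s₁ s₂ x x (profile (suc m) 0 x 0 cCentre 0F)
        (at-slot cCentre 0F (slotAt a ρ) x 0 0F (proj₁ (slots a s s₁ s₂)))
        (at-slot cCentre 0F (slotAt (upAxis a) ρ) x 0 2F (proj₁ (proj₂ (slots a s s₁ s₂))))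
        (at-slot cCentre 0F (slotAt (partner (upAxis a) a) ρ) x 0 2F (proj₂ (proj₂ (slots a s s₁ s₂)))))
      (normals k)
    where
      x = m ℕ.∸ toℕ o
      f : Fin 6
      f = proj₁ (remQuot {6} 4 k)
      a : Fin 3
      a = proj₁ (remQuot {3} 2 f)
      s s₁ s₂ : Fin 2
      s = proj₂ (remQuot {3} 2 f)
      s₁ = proj₁ (remQuot {2} 2 (proj₂ (remQuot {6} 4 k)))
      s₂ = proj₂ (remQuot {2} 2 (proj₂ (remQuot {6} 4 k)))
      ρ : Rot
      ρ = faceRot a s s₁ s₂
      slots : ∀ a s v u → let ρ = faceRot a s v u in
        label cCentre 0F (slotAt a ρ) ≡ 0F × label cCentre 0F (slotAt (upAxis a) ρ) ≡ 2F ×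
        label cCentre 0F (slotAt (partner (upAxis a) a) ρ) ≡ 2F
      slots = from-yes (all? λ a → all? λ s → all? λ v → all? λ u → let ρ = faceRot a s v u in
        (label cCentre 0F (slotAt a ρ) Fin.≟ 0F) ×-dec (label cCentre 0F (slotAt (upAxis a) ρ) Fin.≟ 2F) ×-dec
        (label cCentre 0F (slotAt (partner (upAxis a) a) ρ) Fin.≟ 2F))
      normals : ∀ k → proj₂ (cornerCentreF o k) ≡ pos axial (place cCentre k 0F)
      normals = from-yes (all? λ k → proj₂ (cornerCentreF o k) ≟ⱽ pos axial (place cCentre k 0F))

  eCentre-orbit : ∀ o b k → edgeCentreF o b k ≡ orbit eCentre (m ℕ.∸ toℕ o) (m ℕ.∸ toℕ b) k 0F
  eCentre-orbit o b k = cong₂ _,_ (trans (cong proj₁ (trans edgeCentre-face (cong₂ (faceF f) (proj₁ (signs q)) (proj₂ (signs q))))) position) (normals k)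
    where
      x = m ℕ.∸ toℕ o
      y = m ℕ.∸ toℕ b
      f : Fin 6
      f = proj₁ (remQuot {6} 4 k)
      a : Fin 3
      a = proj₁ (remQuot {3} 2 f)
      s : Fin 2
      s = proj₂ (remQuot {3} 2 f)
      q : Fin 4
      q = proj₂ (remQuot {6} 4 k)
      vertical horizontal : Fin 4 → Fin 4
      vertical 0F = 2F
      vertical 1F = 3F
      vertical 2F = 2F
      vertical 3F = 3F
      horizontal 0F = 3F
      horizontal 1F = 2F
      horizontal 2F = 3F
      horizontal 3F = 2F
      slots : ∀ a s q → let ρ = edgeRot a s q in
        label eCentre 0F (slotAt a ρ) ≡ 0F × label eCentre 0F (slotAt (upAxis a) ρ) ≡ vertical q ×
        label eCentre 0F (slotAt (partner (upAxis a) a) ρ) ≡ horizontal q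
      slots = from-yes (all? λ a → all? λ s → all? λ q → let ρ = edgeRot a s q in
        (label eCentre 0F (slotAt a ρ) Fin.≟ 0F) ×-dec (label eCentre 0F (slotAt (upAxis a) ρ) Fin.≟ vertical q) ×-dec
        (label eCentre 0F (slotAt (partner (upAxis a) a) ρ) Fin.≟ horizontal q))
      down right : Fin 4 → ℤ
      down 0F = - + x
      down 1F = - + y
      down 2F = + x
      down 3F = + y
      right 0F = - + y
      right 1F = + x
      right 2F = + y
      right 3F = - + x
      edgeCentre-face : edgeCentreF o b k ≡ faceF f (down q) (right q)
      -- `remQuot` is `quotRem` with its components exchanged; abstracting the latter reduces both
      -- sides at once.
      edgeCentre-face with Fin.quotRem {6} 4 k
      ... | 0F , _ = refl
      ... | 1F , _ = refl
      ... | 2F , _ = refl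
      ... | 3F , _ = refl
      plus : ∀ n → + n ≡ sg 0F ℤ.* + n
      plus n = sym (ℤₚ.*-identityˡ (+ n))
      minus : ∀ n → - + n ≡ sg 1F ℤ.* + n
      minus n = sym (ℤₚ.-1*i≡-i (+ n))
      signs : ∀ q → down q ≡ sg (vSign q) ℤ.* + value x y (vertical q) × right q ≡ sg (uSign q) ℤ.* + value x y (horizontal q)
      signs 0F = minus x , minus y
      signs 1F = minus y , plus x
      signs 2F = plus x , plus y
      signs 3F = plus y , minus x
      ρ : Rot
      ρ = edgeRot a s q
      sl = slots a s q
      position : proj₁ (faceF f (sg (vSign q) ℤ.* + value x y (vertical q)) (sg (uSign q) ℤ.* + value x y (horizontal q))) ≡
                 pos (+_ ∘ profile (suc m) 0 x y eCentre 0F) ρ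
      position = face-position f (vSign q) (uSign q) _ _ (profile (suc m) 0 x y eCentre 0F)
              (at-slot eCentre 0F (slotAt a ρ) x y 0F (proj₁ sl))
              (at-slot eCentre 0F (slotAt (upAxis a) ρ) x y (vertical q) (proj₁ (proj₂ sl)))
              (at-slot eCentre 0F (slotAt (partner (upAxis a) a) ρ) x y (horizontal q) (proj₂ (proj₂ sl)))
      normals : ∀ k → proj₂ (edgeCentreF o b k) ≡ pos axial (place eCentre k 0F)
      normals = from-yes (all? λ k → proj₂ (edgeCentreF o b k) ≟ⱽ pos axial (place eCentre k 0F))

  centre : Fin 3 → ℤ → ℤ → Facelet
  centre 0F h n = v3 h (+ 0) (+ 0) , v3 n (+ 0) (+ 0)
  centre 1F h n = v3 (+ 0) h (+ 0) , v3 (+ 0) n (+ 0)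
  centre 2F h n = v3 (+ 0) (+ 0) h , v3 (+ 0) (+ 0) n

  faceCentre-centre : ∀ f → let (a , s) = remQuot {3} 2 f in faceCentre f ≡ centre a (sg s ℤ.* H) (sg s)
  faceCentre-centre = λ where
      0F → cong₂ _,_ (cong₃ v3 (along H (+ 1)) (across H) (across H)) refl
      1F → cong₂ _,_ (cong₃ v3 (along H -[1+ 0 ]) (across H) (across H)) refl
      2F → cong₂ _,_ (cong₃ v3 (across H) (along H (+ 1)) (across H)) refl
      3F → cong₂ _,_ (cong₃ v3 (across H) (along H -[1+ 0 ]) (across H)) refl
      4F → cong₂ _,_ (cong₃ v3 (across H) (across H) (along H (+ 1))) refl
      5F → cong₂ _,_ (cong₃ v3 (across H) (across H) (along H -[1+ 0 ])) refl
    where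
      along : ∀ h s → h ℤ.* s ℤ.+ + 0 ≡ s ℤ.* h
      along = solveℤ-∀
      across : ∀ h → h ℤ.* + 0 ℤ.+ + 0 ≡ + 0
      across = solveℤ-∀

  0≢sliceCoord : ∀ a s k → does (+ 0 ℤ.≟ sliceCoord (mv a s k)) ≡ false
  0≢sliceCoord a s k with depth-suc k
  0≢sliceCoord a 0F k | c , e rewrite e = refl
  0≢sliceCoord a 1F k | c , e rewrite e = refl

  -- A turn about its own axis fixes the face centre; a turn about another axis misses it, since its
  -- coordinate there is 0 and the middle layer is never turned.
  applyMove-centre : ∀ x a h n → applyMove x (centre a h n) ≡ centre a h n
  applyMove-centre (mv a s k) a′ h n = lemma a a′ s
    where
      lemma : ∀ a a′ s → applyMove (mv a s k) (centre a′ h n) ≡ centre a′ h n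
      lemma 0F 0F 0F with does (h ℤ.≟ sliceCoord (mv 0F 0F k))
      ... | true = refl
      ... | false = refl
      lemma 0F 0F 1F with does (h ℤ.≟ sliceCoord (mv 0F 1F k))
      ... | true = refl
      ... | false = refl
      lemma 1F 1F 0F with does (h ℤ.≟ sliceCoord (mv 1F 0F k))
      ... | true = refl
      ... | false = refl
      lemma 1F 1F 1F with does (h ℤ.≟ sliceCoord (mv 1F 1F k))
      ... | true = refl
      ... | false = refl
      lemma 2F 2F 0F with does (h ℤ.≟ sliceCoord (mv 2F 0F k))
      ... | true = refl
      ... | false = refl
      lemma 2F 2F 1F with does (h ℤ.≟ sliceCoord (mv 2F 1F k))
      ... | true = refl
      ... | false = refl
      lemma 0F 1F s rewrite 0≢sliceCoord 0F s k = refl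
      lemma 0F 2F s rewrite 0≢sliceCoord 0F s k = refl
      lemma 1F 0F s rewrite 0≢sliceCoord 1F s k = refl
      lemma 1F 2F s rewrite 0≢sliceCoord 1F s k = refl
      lemma 2F 0F s rewrite 0≢sliceCoord 2F s k = refl
      lemma 2F 1F s rewrite 0≢sliceCoord 2F s k = refl

  run-faceCentre : ∀ ms f → run ms (faceCentre f) ≡ faceCentre f
  run-faceCentre ms f rewrite faceCentre-centre f = lemma ms
    where
      a : Fin 3
      a = proj₁ (remQuot {3} 2 f)
      t : ℤ
      t = sg (proj₂ (remQuot {3} 2 f))
      lemma : ∀ ms → run ms (centre a (t ℤ.* H) t) ≡ centre a (t ℤ.* H) t
      lemma []       = refl
      lemma (x ∷ ms) = trans (cong (run ms) (applyMove-centre x a (t ℤ.* H) t)) (lemma ms)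

-- Permutations and signs of single moves.

ofOrderFour : ∀ {k} (f : Fin k → Fin k) → (∀ i → f (f (f (f i))) ≡ i) → Permutation′ k
ofOrderFour f f⁴ = permutation f (f ∘ f ∘ f) f⁴ f⁴

find : ∀ {n} → (Fin n → Bool) → Maybe (Fin n)
find {zero}  p = nothing
find {suc n} p = if p zero then just zero else Maybe.map suc (find (p ∘ suc))

-- Counts 4-cycles modulo 2. An outer turn moves eight coupled edges of an orbit, in two cycles, but
-- only four facelets of each centre orbit, all on its own face. An inner slice turn moves four
-- coupled edges and eight centre corners of its own index, and one facelet on each of four faces in
-- every centre edge orbit that involves it.
moveParity : Kind → Bool → Bool → Bool → ℤ
moveParity coupled bh bx by = sign bx
moveParity cCentre bh bx by = sign bh
moveParity _       bh bx by = sign bh ℤ.* sign bx ℤ.* sign by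

anySticker : ∀ κ → Fin (stickers κ)
anySticker corner  = 0F
anySticker single  = 0F
anySticker coupled = 0F
anySticker cCentre = 0F
anySticker eCentre = 0F

module _ (κ : Kind) (bh bx by : Bool) (a : Fin 3) (s : Fin 2) where

  HasPermutation : Set
  HasPermutation = ∃[ π ]
    (∀ k j → act (profile bh false bx by κ j) a s (place κ k j) ≡ place κ (π ⟨$⟩ʳ k) j) ×
    sgn π ≡ moveParity κ bh bx by

  -- The default k is never reached.
  move : Fin (size κ) → Fin (size κ)
  move k = fromMaybe k (find λ i → does (place κ i j ≟ᴿ act (profile bh false bx by κ j) a s (place κ k j)))
    where
      j = anySticker κ

  Tabulated : Vec (Fin (size κ)) (size κ) → Set
  Tabulated v = (∀ k j → act (profile bh false bx by κ j) a s (place κ k j) ≡ place κ (lookup v k) j) ×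
                (∀ k → lookup v (lookup v (lookup v (lookup v k))) ≡ k) ×
                parity (lookup v) ≡ moveParity κ bh bx by

  tabulated? : ∀ v → Dec (Tabulated v)
  tabulated? v =
    all? (λ k → all? λ j → act (profile bh false bx by κ j) a s (place κ k j) ≟ᴿ place κ (lookup v k) j) ×-dec
    all? (λ k → lookup v (lookup v (lookup v (lookup v k))) Fin.≟ k) ×-dec
    (parity (lookup v) ℤ.≟ moveParity κ bh bx by)

  tabulated⇒ : ∀ v → Tabulated v → HasPermutation
  tabulated⇒ v (p , q , e) = ofOrderFour (lookup v) q , p , e

  table : Vec (Fin (size κ)) (size κ)
  table = tabulate move

  trivial : (∀ j i → profile bh false bx by κ j i ≡ false) → moveParity κ bh bx by ≡ + 1 → HasPermutation
  trivial none e = idₚ ,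
    (λ k j → cong (λ c → if c then turnRot a s (place κ k j) else place κ k j)
      (trans (cong (does (signAt a (place κ k j) Fin.≟ s) ∧_) (none j (slotAt a (place κ k j))))
        (∧-zeroʳ (does (signAt a (place κ k j) Fin.≟ s))))) ,
    trans (parity-id (size κ)) (sym e)

-- The distances H, x, y are distinct, so a slice lies at no more than one of them and four of the
-- eight truth patterns remain.
data Hit : Bool → Bool → Bool → Set where
  none   : Hit false false false
  outer  : Hit true  false false
  first  : Hit false true  false
  second : Hit false false true

abstract
  coupled-move : ∀ {bh bx by} → Hit bh bx by → ∀ a s → HasPermutation coupled bh bx by a s
  coupled-move none a s = trivial coupled false false false a s
    (λ { 0F 0F → refl ; 0F 1F → refl ; 0F 2F → refl ; 1F 0F → refl ; 1F 1F → refl ; 1F 2F → refl }) refl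
  coupled-move second a s = trivial coupled false false true a s
    (λ { 0F 0F → refl ; 0F 1F → refl ; 0F 2F → refl ; 1F 0F → refl ; 1F 1F → refl ; 1F 2F → refl }) refl
  coupled-move outer a s = tabulated⇒ coupled true false false a s (table coupled true false false a s)
    (from-yes (all? λ a → all? λ s → tabulated? coupled true false false a s (table coupled true false false a s)) a s)
  coupled-move first a s = tabulated⇒ coupled false true false a s (table coupled false true false a s)
    (from-yes (all? λ a → all? λ s → tabulated? coupled false true false a s (table coupled false true false a s)) a s)

  cCentre-move : ∀ {bh bx by} → Hit bh bx by → ∀ a s → HasPermutation cCentre bh bx by a s
  cCentre-move none a s = trivial cCentre false false false a s (λ { j 0F → refl ; j 1F → refl ; j 2F → refl }) refl
  cCentre-move second a s = trivial cCentre false false true a s (λ { j 0F → refl ; j 1F → refl ; j 2F → refl }) refl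
  cCentre-move outer a s = tabulated⇒ cCentre true false false a s (table cCentre true false false a s)
    (from-yes (all? λ a → all? λ s → tabulated? cCentre true false false a s (table cCentre true false false a s)) a s)
  cCentre-move first a s = tabulated⇒ cCentre false true false a s (table cCentre false true false a s)
    (from-yes (all? λ a → all? λ s → tabulated? cCentre false true false a s (table cCentre false true false a s)) a s)

  eCentre-move : ∀ {bh bx by} → Hit bh bx by → ∀ a s → HasPermutation eCentre bh bx by a s
  eCentre-move none a s = trivial eCentre false false false a s (λ { j 0F → refl ; j 1F → refl ; j 2F → refl }) refl
  eCentre-move outer a s = tabulated⇒ eCentre true false false a s (table eCentre true false false a s)
    (from-yes (all? λ a → all? λ s → tabulated? eCentre true false false a s (table eCentre true false false a s)) a s)
  eCentre-move first a s = tabulated⇒ eCentre false true false a s (table eCentre false true false a s)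
    (from-yes (all? λ a → all? λ s → tabulated? eCentre false true false a s (table eCentre false true false a s)) a s)
  eCentre-move second a s = tabulated⇒ eCentre false false true a s (table eCentre false false true a s)
    (from-yes (all? λ a → all? λ s → tabulated? eCentre false false true a s (table eCentre false false true a s)) a s)

-- Move sequences: closure, generation and counts of turns.

module Solve (m : ℕ) where
  open Cube m
  open Semantics m
  open Facelets m
  open Words

  module _ {N J} (φ : Fin N → Fin J → Facelet) where

    ActsOn : List Move → (Fin N → Fin N) → Set
    ActsOn w f = ∀ k j → run w (φ k j) ≡ φ (f k) j

    ActsOn-++ : ∀ u {v f g} → ActsOn u f → ActsOn v g → ActsOn (u ++ v) (g ∘ f)
    ActsOn-++ u {v} {f} p q k j = trans (run-++ u v (φ k j)) (trans (cong (run v) (p k j)) (q (f k) j))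

    ActsOn-cong : ∀ w {f g} → f ≗ g → ActsOn w f → ActsOn w g
    ActsOn-cong w e p k j = trans (p k j) (cong (λ i → φ i j) (e k))

  TwistsBy : ∀ {N J} (φ : Fin N → Fin (suc J) → Facelet) → List Move → (Fin N → ℕ) → Set
  TwistsBy φ w t = ∀ k j → run w (φ k j) ≡ φ k (shift j (t k))

  record Closed (Base : List Move → Set) : Set where
    field
      empty  : Base []
      append : ∀ u {v} → Base u → Base v → Base (u ++ v)
  open Closed

  Closed-× : ∀ {A B} → Closed A → Closed B → Closed (λ w → A w × B w)
  Closed-× a b .empty                       = a .empty , b .empty
  Closed-× a b .append u (p , q) (p′ , q′) = a .append u p p′ , b .append u q q′

  Closed-∀ : ∀ {I : Set} {A : I → List Move → Set} → (∀ i → Closed (A i)) → Closed (λ w → ∀ i → A i w)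
  Closed-∀ a .empty i            = a i .empty
  Closed-∀ a .append u p q i = a i .append u (p i) (q i)

  Fixes-closed : ∀ {N J} (φ : Fin N → Fin J → Facelet) → Closed (λ w → ActsOn φ w id)
  Fixes-closed φ .empty k j     = refl
  Fixes-closed φ .append u p q = ActsOn-++ φ u p q

  turns : ℕ → List Move → ℤ
  turns x []             = + 1
  turns x (mv a s k ∷ w) = sign (does (x ℕ.≟ depth k)) ℤ.* turns x w

  turns-++ : ∀ x u v → turns x (u ++ v) ≡ turns x u ℤ.* turns x v
  turns-++ x []             v = sym (ℤₚ.*-identityˡ _)
  turns-++ x (mv a s k ∷ u) v = trans (cong (sign (does (x ℕ.≟ depth k)) ℤ.*_) (turns-++ x u v))
    (sym (ℤₚ.*-assoc (sign (does (x ℕ.≟ depth k))) (turns x u) (turns x v)))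

  turns-0 : ∀ w → turns 0 w ≡ + 1
  turns-0 []             = refl
  turns-0 (mv a s k ∷ w) with depth-suc k
  ... | c , e rewrite e = trans (ℤₚ.*-identityˡ _) (turns-0 w)

  turns-closed : ∀ x → Closed (λ w → turns x w ≡ + 1)
  turns-closed x .empty               = refl
  turns-closed x .append u {v} p q = trans (turns-++ x u v) (cong₂ ℤ._*_ p q)

  δ : ∀ {k} → Fin k → ℕ
  δ o = m ℕ.∸ toℕ o

  Quiet : List Move → Set
  Quiet w = turns (suc m) w ≡ + 1 × (∀ (o : Fin m) → turns (δ o) w ≡ + 1)

  Quiet-closed : Closed Quiet
  Quiet-closed = Closed-× (turns-closed (suc m)) (Closed-∀ (turns-closed ∘ δ))

  module _ {Base : List Move → Set} (closed : Closed Base) where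

    generate : ∀ {n J} (φ : Fin (suc (suc (suc n))) → Fin J → Facelet) →
      (∀ i → ∃[ w ] Base w × ActsOn φ w (cycle i)) →
      ∀ f → Inj f → parity f ≡ + 1 → ∃[ w ] Base w × ActsOn φ w f
    generate φ = Generation.even⇒P (λ f → ∃[ w ] Base w × ActsOn φ w f)
      (λ { e (w , base , acts) → w , base , ActsOn-cong φ w e acts })
      ([] , closed .empty , λ k j → refl)
      (λ { (u , base , acts) (v , base′ , acts′) →
           u ++ v , closed .append u base base′ , ActsOn-++ φ u acts acts′ })

    generateTwists : ∀ {n J} (φ : Fin (suc n) → Fin (suc J) → Facelet) →
      (∀ i → ∃[ w ] Base w × TwistsBy φ w (twist J i)) →
      ∀ t → sumFin t % suc J ≡ 0 → ∃[ w ] Base w × TwistsBy φ w t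
    generateTwists {n} {J} φ = twists-generate J (λ t → ∃[ w ] Base w × TwistsBy φ w t)
      (λ { e (w , base , tw) → w , base , λ k j → trans (tw k j) (cong (φ k) (shift-cong j (e k))) })
      ([] , closed .empty , λ k j → cong (φ k) (sym (shift-0 j)))
      (λ { {s} {t} (u , base , tw) (v , base′ , tw′) → u ++ v , closed .append u base base′ ,
           λ k j → trans (run-++ u v (φ k j)) (trans (cong (run v) (tw k j))
             (trans (tw′ k (shift j (s k))) (cong (φ k) (shift-+ j (s k) (t k))))) })

  module _ {Base : List Move → Set} (closed : Closed Base) where

    module _ {I : Set} (_≟ᴵ_ : DecidableEquality I) (Fix Des : I → List Move → Set)
      (Fix-closed : ∀ i → Closed (Fix i))
      (Fix-Des : ∀ i u {v} → Fix i u → Des i v → Des i (u ++ v))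
      (Des-Fix : ∀ i u {v} → Des i u → Fix i v → Des i (u ++ v)) where

      open DecMembership _≟ᴵ_ using (_∈?_)

      -- Each local word fixes all other indices, so the concatenation has every local effect. `Fix`
      -- and `Des` are kept abstract because this serves for permutations of orbits and also for
      -- parities of slice turns.
      combine : ∀ L → (∀ {i} → i ∈ L → ∃[ w ] Base w × Des i w × (∀ i′ → i′ ≢ i → Fix i′ w)) →
        ∃[ w ] Base w × (∀ {i} → i ∈ L → Des i w) × (∀ {i} → i ∉ L → Fix i w)
      combine []      h = [] , closed .empty , (λ ()) , λ {i} _ → Fix-closed i .empty
      combine (x ∷ L) h with combine L (h ∘ there) | x ∈? L
      -- A repeated index is already taken care of; performing its word twice would in general spoil
      -- the effect.
      ... | w , base , des , fix | yes x∈L = w , base ,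
        (λ { (here refl) → des x∈L ; (there i∈L) → des i∈L }) ,
        (λ i∉ → fix (i∉ ∘ there))
      ... | w , base , des , fix | no x∉L with h (here refl)
      ...   | w′ , base′ , des′ , fix′ = w ++ w′ , closed .append w base base′ ,
        (λ { (here refl)     → Fix-Des x w (fix x∉L) des′
           ; {i} (there i∈L) → Des-Fix i w (des i∈L) (fix′ i λ { refl → x∉L i∈L }) }) ,
        (λ {i} i∉ → Fix-closed i .append w (fix (i∉ ∘ there)) (fix′ i λ { refl → i∉ (here refl) }))

    -- Once the signs agree, the quotient by the current permutation is even, and
    -- it is a product of 3-cycles which do not disturb one another's orbits.
    settle : ∀ {n J} {I : Set} (_≟ᴵ_ : DecidableEquality I)
      (φ : I → Fin (suc (suc (suc n))) → Fin J → Facelet) (τ : I → Permutation′ (suc (suc (suc n)))) ms L →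
      (∀ {i} → i ∈ L → ∃[ π ] ActsOn (φ i) ms (π ⟨$⟩ʳ_) × sgn π ≡ sgn (τ i)) →
      (∀ {i} → i ∈ L → ∀ c → ∃[ w ] Base w × ActsOn (φ i) w (cycle c) × (∀ i′ → i′ ≢ i → ActsOn (φ i′) w id)) →
      ∃[ w ] Base w × (∀ {i} → i ∈ L → ActsOn (φ i) (ms ++ w) (τ i ⟨$⟩ʳ_))
    settle _≟ᴵ_ φ τ ms L current cycles
      = let w , base , des , _ = combine _≟ᴵ_ (λ i w → ActsOn (φ i) w id) Des (Fixes-closed ∘ φ)
              (λ { i u fix (π , p , q) → π , p , ActsOn-++ (φ i) u fix q })
              (λ { i u (π , p , q) fix → π , p , ActsOn-++ (φ i) u q fix })
              L local
        in w , base , λ {i} i∈L → done i w (des i∈L)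
      where
        Des : _ → List Move → Set
        Des i w = ∃[ π ] ActsOn (φ i) ms (π ⟨$⟩ʳ_) × ActsOn (φ i) w (quotient (τ i) π)
        local : ∀ {i} → i ∈ L → ∃[ w ] Base w × Des i w × (∀ i′ → i′ ≢ i → ActsOn (φ i′) w id)
        local {i} i∈L with current i∈L
        -- Words for orbit `i` must also keep the other orbits of the family, so this is added to
        -- what `generate` preserves.
        ... | π , acts , e with generate (Closed-× closed (Closed-∀ λ i′ → Closed-∀ λ _ → Fixes-closed (φ i′))) (φ i)
                                 (λ c → let w , base , cyc , fix = cycles i∈L c in w , (base , fix) , cyc)
                                 (quotient (τ i) π) (quotient-injective (τ i) π) (quotient-even (τ i) π (sym e))
        ...   | w , (base , fix) , acts′ = w , base , (π , acts , acts′) , fix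
        done : ∀ i w → Des i w → ActsOn (φ i) (ms ++ w) (τ i ⟨$⟩ʳ_)
        done i w (π , p , q) = ActsOn-cong (φ i) (ms ++ w) (quotient-∘ (τ i) π) (ActsOn-++ (φ i) ms p q)

  wordParity-nothing : ∀ {p} (w : Word p) → wordParity nothing w ≡ + 1
  wordParity-nothing []             = refl
  wordParity-nothing (tn a s ℓ ∷ w) = trans (ℤₚ.*-identityˡ _) (wordParity-nothing w)

  hit : ∀ {A B C : Set} (p? : Dec A) (q? : Dec B) (r? : Dec C) →
        ¬ (A × B) → ¬ (A × C) → ¬ (B × C) → Hit (does p?) (does q?) (does r?)
  hit (yes p) (yes q) _       ¬ab ¬ac ¬bc = contradiction (p , q) ¬ab
  hit (yes p) (no _)  (yes r) ¬ab ¬ac ¬bc = contradiction (p , r) ¬ac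
  hit (yes p) (no _)  (no _)  ¬ab ¬ac ¬bc = outer
  hit (no _)  (yes q) (yes r) ¬ab ¬ac ¬bc = contradiction (q , r) ¬bc
  hit (no _)  (yes q) (no _)  ¬ab ¬ac ¬bc = first
  hit (no _)  (no _)  (yes r) ¬ab ¬ac ¬bc = second
  hit (no _)  (no _)  (no _)  ¬ab ¬ac ¬bc = none

  movesParity : Kind → ℕ → ℕ → List Move → ℤ
  movesParity κ x y []             = + 1
  movesParity κ x y (mv a s k ∷ w) =
    moveParity κ (does (suc m ℕ.≟ depth k)) (does (x ℕ.≟ depth k)) (does (y ℕ.≟ depth k)) ℤ.* movesParity κ x y w

  movesParity-coupled : ∀ x y w → movesParity coupled x y w ≡ turns x w
  movesParity-coupled x y []             = refl
  movesParity-coupled x y (mv a s k ∷ w) = cong (sign (does (x ℕ.≟ depth k)) ℤ.*_) (movesParity-coupled x y w)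

  movesParity-cCentre : ∀ x y w → movesParity cCentre x y w ≡ turns (suc m) w
  movesParity-cCentre x y []             = refl
  movesParity-cCentre x y (mv a s k ∷ w) = cong (sign (does (suc m ℕ.≟ depth k)) ℤ.*_) (movesParity-cCentre x y w)

  movesParity-eCentre : ∀ x y w → movesParity eCentre x y w ≡ turns (suc m) w ℤ.* turns x w ℤ.* turns y w
  movesParity-eCentre x y []             = refl
  movesParity-eCentre x y (mv a s k ∷ w) =
    trans (cong (sign (does (suc m ℕ.≟ depth k)) ℤ.* sign (does (x ℕ.≟ depth k)) ℤ.* sign (does (y ℕ.≟ depth k)) ℤ.*_)
            (movesParity-eCentre x y w))
      (regroup (sign (does (suc m ℕ.≟ depth k))) (sign (does (x ℕ.≟ depth k))) (sign (does (y ℕ.≟ depth k)))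
        (turns (suc m) w) (turns x w) (turns y w))
    where
      regroup : ∀ a b c d e f → a ℤ.* b ℤ.* c ℤ.* (d ℤ.* e ℤ.* f) ≡ (a ℤ.* d) ℤ.* (b ℤ.* e) ℤ.* (c ℤ.* f)
      regroup = solveℤ-∀

  module _ (κ : Kind) {x y : ℕ} (x≤m : x ≤ m) (y≤m : y ≤ m) (x≢y : x ≢ y)
    (permutations : ∀ {bh bx by} → Hit bh bx by → ∀ a s → HasPermutation κ bh bx by a s) where

    -- `settle` needs to know of the position reached only that it is some permutation of computable
    -- sign. The bound m on `x` and `y` separates them from the outer distance `suc m`.
    currentPermutation : ∀ ms → ∃[ π ] ActsOn (orbit κ x y) ms (π ⟨$⟩ʳ_) × sgn π ≡ movesParity κ x y ms
    currentPermutation [] = idₚ , (λ k j → refl) , parity-id (size κ)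
    currentPermutation (mv a s k ∷ ms)
      with permutations (hit (suc m ℕ.≟ depth k) (x ℕ.≟ depth k) (y ℕ.≟ depth k)
             (λ { (p , q) → ℕₚ.<⇒≢ (ℕ.s≤s x≤m) (trans q (sym p)) })
             (λ { (p , q) → ℕₚ.<⇒≢ (ℕ.s≤s y≤m) (trans q (sym p)) })
             (λ { (p , q) → x≢y (trans p (sym q)) })) a s
         | currentPermutation ms
    ... | π , acts , e | π′ , acts′ , e′ = π ∘ₚ π′ ,
      (λ i j → trans (cong (run ms) (step i j)) (acts′ (π ⟨$⟩ʳ i) j)) ,
      trans (parity-∘ (π′ ⟨$⟩ʳ_) (π ⟨$⟩ʳ_) (to-injective π′) (to-injective π))
        (trans (ℤₚ.*-comm (sgn π′) (sgn π)) (cong₂ ℤ._*_ e e′))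
      where
        step : ∀ i j → applyMove (mv a s k) (orbit κ x y i j) ≡ orbit κ x y (π ⟨$⟩ʳ i) j
        step i j = trans (applyMove-facelet M a s k (place κ i j)) (cong (facelet M)
          (trans (act-cong (profile-map (λ v → does (v ℕ.≟ depth k)) {suc m} {0} {x} {y} refl (does-0≟depth k) refl refl κ j)
                   a s (place κ i j))
            (acts i j)))
          where
            M : Fin 3 → ℕ
            M = profile (suc m) 0 x y κ j

  -- Placing symbolic layers in the actual cube.

  depth-injective : ∀ {k l} → depth k ≡ depth l → k ≡ l
  depth-injective {k} {l} e = toℕ-injective (ℕₚ.∸-cancelˡ-≡ (ℕₚ.<⇒≤ (toℕ<n k)) (ℕₚ.<⇒≤ (toℕ<n l)) e)

  module Layered {p : ℕ} (layer : Fin (suc p) → Fin (suc m))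
    (layer-zero : layer zero ≡ zero) (layer-injective : ∀ {i j} → layer i ≡ layer j → i ≡ j) where

    open Concrete layer public

    layer-class : ∀ ℓ → HasClass (depth (layer ℓ)) (just ℓ)
    layer-class ℓ ℓ′ with ℓ Fin.≟ ℓ′
    ... | yes refl = dec-true (depth (layer ℓ) ℕ.≟ depth (layer ℓ)) refl
    ... | no  ℓ≢ℓ′ = dec-false (depth (layer ℓ) ℕ.≟ depth (layer ℓ′)) (ℓ≢ℓ′ ∘ layer-injective ∘ depth-injective)

    outer-class : HasClass (suc m) (just zero)
    outer-class = subst (λ k → HasClass (depth k) (just zero)) layer-zero (layer-class zero)

    zero-class : HasClass 0 nothing
    zero-class ℓ = does-0≟depth (layer ℓ)

    -- The last component makes it possible to recognise an orbit from the classes of its distances.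
    inner-class : ∀ {x} → x ≤ m → ∃[ i ] HasClass x (inner i) × (∀ {ℓ} → i ≡ suc ℓ → x ≡ depth (layer (suc ℓ)))
    inner-class {x} x≤m with any? (λ ℓ → x ℕ.≟ depth (layer ℓ))
    ... | yes (zero  , refl) = contradiction x≤m (ℕₚ.<⇒≱ (subst (λ k → m < depth k) (sym layer-zero) ℕₚ.≤-refl))
    ... | yes (suc i , refl) = suc i , layer-class (suc i) , λ { refl → refl }
    ... | no  absent         = zero , (λ ℓ → dec-false (x ℕ.≟ depth (layer ℓ)) λ e → absent (ℓ , e)) , λ ()

    absent-class : ∀ {x} → x ≤ m → (∀ ℓ → x ≢ depth (layer (suc ℓ))) → HasClass x nothing
    absent-class {x} x≤m x≢ zero    = dec-false (x ℕ.≟ depth (layer zero))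
      λ e → ℕₚ.<⇒≱ (subst (λ k → m < depth k) (sym layer-zero) ℕₚ.≤-refl) (subst (_≤ m) e x≤m)
    absent-class {x} x≤m x≢ (suc ℓ) = dec-false (x ℕ.≟ depth (layer (suc ℓ))) (x≢ ℓ)

    acts : ∀ κ x y cx cy → HasClass x cx → HasClass y cy → ∀ w f → Permutes cx cy κ w f →
           ActsOn (orbit κ x y) (concrete w) f
    acts κ x y cx cy hx hy w f perm = run-orbit κ x y cx cy outer-class hx hy w (λ k j → place κ (f k) j) perm

    acts₀ : ∀ κ w f → Permutes nothing nothing κ w f → ActsOn (orbit κ 0 0) (concrete w) f
    acts₀ κ = acts κ 0 0 nothing nothing zero-class zero-class

    turns-concrete : ∀ {x c} → HasClass x c → ∀ w → turns x (concrete w) ≡ wordParity c w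
    turns-concrete h []             = refl
    turns-concrete h (tn a s ℓ ∷ w) = cong₂ ℤ._*_ (cong sign (h ℓ)) (turns-concrete h w)

    quiet : ∀ w → Balanced w → Quiet (concrete w)
    quiet w bal = trans (turns-concrete outer-class w) (bal zero) , inside
      where
        inside : ∀ o → turns (δ o) (concrete w) ≡ + 1
        inside o with inner-class (ℕₚ.m∸n≤m m (toℕ o))
        ... | zero  , h , _ = trans (turns-concrete h w) (wordParity-nothing w)
        ... | suc i , h , _ = trans (turns-concrete h w) (bal (suc i))

  δ-injective : ∀ {o o′ : Fin m} → δ o ≡ δ o′ → o ≡ o′
  δ-injective {o} {o′} e = toℕ-injective (ℕₚ.∸-cancelˡ-≡ (ℕₚ.<⇒≤ (toℕ<n o)) (ℕₚ.<⇒≤ (toℕ<n o′)) e)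

  δ≤m : ∀ {k} (o : Fin k) → δ o ≤ m
  δ≤m o = ℕₚ.m∸n≤m m (toℕ o)

  δ≢0 : ∀ (o : Fin m) → δ o ≢ 0
  δ≢0 o e = ℕₚ.<⇒≢ (ℕₚ.m<n⇒0<n∸m (toℕ<n o)) (sym e)

  layer₁ : Fin 1 → Fin (suc m)
  layer₁ _ = zero

  layer₁-injective : ∀ {i j} → layer₁ i ≡ layer₁ j → i ≡ j
  layer₁-injective {0F} {0F} _ = refl

  module Outer = Layered {0} layer₁ refl layer₁-injective

  -- Orbit `o` belongs to slice `suc o`, whose depth is `δ o`, because slice zero is the outer one.
  layer₂ : Fin m → Fin 2 → Fin (suc m)
  layer₂ o 0F = zero
  layer₂ o 1F = suc o

  layer₂-injective : ∀ o {i j} → layer₂ o i ≡ layer₂ o j → i ≡ j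
  layer₂-injective o {0F} {0F} e = refl
  layer₂-injective o {1F} {1F} e = refl
  layer₂-injective o {0F} {1F} ()
  layer₂-injective o {1F} {0F} ()

  module Inner (o : Fin m) where
    open Layered {1} (layer₂ o) refl (layer₂-injective o) public

    other-class : ∀ o′ → o′ ≢ o → HasClass (δ o′) nothing
    other-class o′ o′≢o = absent-class (δ≤m o′) λ { 0F e → o′≢o (δ-injective e) }

  layer₃ : Fin m → Fin m → Fin 3 → Fin (suc m)
  layer₃ o b 0F = zero
  layer₃ o b 1F = suc o
  layer₃ o b 2F = suc b

  layer₃-injective : ∀ {o b} → o ≢ b → ∀ {i j} → layer₃ o b i ≡ layer₃ o b j → i ≡ j
  layer₃-injective o≢b {0F} {0F} e = refl
  layer₃-injective o≢b {1F} {1F} e = refl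
  layer₃-injective o≢b {2F} {2F} e = refl
  layer₃-injective o≢b {0F} {1F} ()
  layer₃-injective o≢b {0F} {2F} ()
  layer₃-injective o≢b {1F} {0F} ()
  layer₃-injective o≢b {2F} {0F} ()
  layer₃-injective o≢b {1F} {2F} e = contradiction (suc-injective e) o≢b
  layer₃-injective o≢b {2F} {1F} e = contradiction (sym (suc-injective e)) o≢b

  module Double {o b : Fin m} (o≢b : o ≢ b) = Layered {2} (layer₃ o b) refl (layer₃-injective o≢b)

  corners : Fin 8 → Fin 3 → Facelet
  corners = orbit corner 0 0

  singles : Fin 12 → Fin 2 → Facelet
  singles = orbit single 0 0

  coupleds : Fin m → Fin 24 → Fin 2 → Facelet
  coupleds o = orbit coupled (δ o) 0

  pluses crosses : Fin m → Fin 24 → Fin 1 → Facelet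
  pluses  o = orbit eCentre (δ o) 0
  crosses o = orbit cCentre (δ o) 0

  obliques : Fin m × Fin (suc m) → Fin 24 → Fin 1 → Facelet
  obliques (o , b) = orbit eCentre (δ o) (δ b)

  Base₁ Base₂ Base₃ Base₄ : List Move → Set
  Base₁ w = (ActsOn corners w id × ActsOn singles w id) × Quiet w
  Base₂ w = Base₁ w × (∀ o → ActsOn (coupleds o) w id)
  Base₃ w = Base₂ w × (∀ o → ActsOn (pluses o) w id)
  Base₄ w = Base₃ w × (∀ o → ActsOn (crosses o) w id)

  closed₁ : Closed Base₁
  closed₁ = Closed-× (Closed-× (Fixes-closed corners) (Fixes-closed singles)) Quiet-closed
  closed₂ : Closed Base₂
  closed₂ = Closed-× closed₁ (Closed-∀ (Fixes-closed ∘ coupleds))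
  closed₃ : Closed Base₃
  closed₃ = Closed-× closed₂ (Closed-∀ (Fixes-closed ∘ pluses))
  closed₄ : Closed Base₄
  closed₄ = Closed-× closed₃ (Closed-∀ (Fixes-closed ∘ crosses))


  run-⨾ : ∀ u v {f g h} → run u f ≡ g → run v g ≡ h → run (u ++ v) f ≡ h
  run-⨾ u v {f} p q = trans (run-++ u v f) (trans (cong (run v) p) q)

  -- Settling a given configuration.

  module _ (c : Conf) (cond₁ : Cond1 c) (cond₂ : Cond2 c) (cond₃ : Cond3 c) (cond₄ : Cond4 c) where
    open Conf c

    slices : ∃[ w ] ((ActsOn corners w id × ActsOn singles w id) × turns (suc m) w ≡ + 1) ×
                    (∀ o → turns (δ o) w ≡ sgn (τc o))
    slices =
      let w , base , des , _ = combine
            (Closed-× (Closed-× (Fixes-closed corners) (Fixes-closed singles)) (turns-closed (suc m)))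
            Fin._≟_ (λ o w → turns (δ o) w ≡ + 1) (λ o w → turns (δ o) w ≡ sgn (τc o)) (turns-closed ∘ δ)
            (λ o u {v} p q → trans (turns-++ (δ o) u v) (trans (cong₂ ℤ._*_ p q) (ℤₚ.*-identityˡ _)))
            (λ o u {v} p q → trans (turns-++ (δ o) u v) (trans (cong₂ ℤ._*_ p q) (ℤₚ.*-identityʳ _)))
            (allFin m) (λ {o} _ → slice o (negOnePow-±1 (inversions (τc o))))
      in w , base , λ o → des (∈-allFin o)
      where
        slice : ∀ o → sgn (τc o) ≡ + 1 ⊎ sgn (τc o) ≡ -[1+ 0 ] →
          ∃[ w ] ((ActsOn corners w id × ActsOn singles w id) × turns (suc m) w ≡ + 1) ×
                 turns (δ o) w ≡ sgn (τc o) × (∀ o′ → o′ ≢ o → turns (δ o′) w ≡ + 1)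
        slice o (inj₁ e) = [] , (((λ _ _ → refl) , (λ _ _ → refl)) , refl) , sym e , λ _ _ → refl
        slice o (inj₂ e) = concrete sliceTurn ,
          ((acts₀ corner sliceTurn id sliceTurn-corner ,
            acts₀ single sliceTurn id sliceTurn-single) ,
           trans (turns-concrete outer-class sliceTurn) sliceTurn-outer) ,
          trans (turns-concrete (layer-class 1F) sliceTurn) (trans sliceTurn-inner (sym e)) ,
          λ o′ o′≢o → trans (turns-concrete (other-class o′ o′≢o) sliceTurn) (wordParity-nothing sliceTurn)
          where
            open Inner o

    Start : List Move → Set
    Start w = (∃[ π ] ActsOn corners w (π ⟨$⟩ʳ_) × sgn π ≡ sgn σ) ×
              (∃[ π ] ActsOn singles w (π ⟨$⟩ʳ_) × sgn π ≡ sgn σ) ×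
              turns (suc m) w ≡ sgn σ × (∀ (o : Fin m) → turns (δ o) w ≡ + 1)

    start : ∃[ w ] Start w
    start = lemma (negOnePow-±1 (inversions σ))
      where
        open Outer
        lemma : sgn σ ≡ + 1 ⊎ sgn σ ≡ -[1+ 0 ] → ∃[ w ] Start w
        lemma (inj₁ e) = [] , (idₚ , (λ _ _ → refl) , trans (parity-id 8) (sym e)) ,
                        (idₚ , (λ _ _ → refl) , trans (parity-id 12) (sym e)) , sym e , λ _ → refl
        lemma (inj₂ e) = concrete oddWord ,
          (ofOrderFour oddCorners oddCorners⁴ , acts₀ corner oddWord oddCorners oddWord-corner , trans oddCorners-parity (sym e)) ,
          (ofOrderFour oddSingles oddSingles⁴ , acts₀ single oddWord oddSingles oddWord-single , trans oddSingles-parity (sym e)) ,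
          trans (turns-concrete outer-class oddWord) (trans oddWord-parity (sym e)) ,
          λ o → trans (turns-concrete (absent-class (δ≤m o) λ ()) oddWord) (wordParity-nothing oddWord)

    Assembled : List Move → Set
    Assembled w = (∀ k j → run w (corners k j) ≡ corners (σ ⟨$⟩ʳ k) (shift j (toℕ (x (σ ⟨$⟩ʳ k))))) ×
                  (∀ k j → run w (singles k j) ≡ singles (τs ⟨$⟩ʳ k) (shift j (toℕ (z (τs ⟨$⟩ʳ k)))))

    Balance : List Move → Set
    Balance w = turns (suc m) w ≡ sgn σ × (∀ o → turns (δ o) w ≡ sgn (τc o))

    Balance-++ : ∀ u {v} → Balance u → Quiet v → Balance (u ++ v)
    Balance-++ u {v} (p , q) (p′ , q′) =
      keep (suc m) p p′ , λ o → keep (δ o) (q o) (q′ o)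
      where
        keep : ∀ x {s} → turns x u ≡ s → turns x v ≡ + 1 → turns x (u ++ v) ≡ s
        keep x p q = trans (turns-++ x u v) (trans (cong₂ ℤ._*_ p q) (ℤₚ.*-identityʳ _))

    Assembled-++ : ∀ u {v} → Assembled u → ActsOn corners v id × ActsOn singles v id → Assembled (u ++ v)
    Assembled-++ u {v} (p , q) (p′ , q′) =
      (λ k j → run-⨾ u v (p k j) (p′ (σ ⟨$⟩ʳ k) (shift j (toℕ (x (σ ⟨$⟩ʳ k)))))) ,
      (λ k j → run-⨾ u v (q k j) (q′ (τs ⟨$⟩ʳ k) (shift j (toℕ (z (τs ⟨$⟩ʳ k))))))

    module _ where
      open Outer

      cornerClosed : Closed (λ w → ActsOn singles w id × Quiet w)
      cornerClosed = Closed-× (Fixes-closed singles) Quiet-closed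
      singleClosed : Closed (λ w → ActsOn corners w id × Quiet w)
      singleClosed = Closed-× (Fixes-closed corners) Quiet-closed
      cornerWords : ∀ i → ∃[ w ] (ActsOn singles w id × Quiet w) × ActsOn corners w (cycle i)
      cornerWords i = concrete (cornerCycle i) ,
        (acts₀ single (cornerCycle i) id (cornerCycle-single i) ,
         quiet (cornerCycle i) (cornerCycle-balanced i)) ,
        acts₀ corner (cornerCycle i) (cycle i) (cornerCycle-permutes i)
      singleWords : ∀ i → ∃[ w ] (ActsOn corners w id × Quiet w) × ActsOn singles w (cycle i)
      singleWords i = concrete (singleCycle i) ,
        (acts₀ corner (singleCycle i) id (singleCycle-corner i) ,
         quiet (singleCycle i) (singleCycle-balanced i)) ,
        acts₀ single (singleCycle i) (cycle i) (singleCycle-permutes i)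
      twistWords : ∀ i → ∃[ w ] (ActsOn singles w id × Quiet w) × TwistsBy corners w (twist 2 i)
      twistWords i = concrete (cornerTwist i) ,
        (acts₀ single (cornerTwist i) id (cornerTwist-single i) ,
         quiet (cornerTwist i) (cornerTwist-balanced i)) ,
        run-orbit corner 0 0 nothing nothing outer-class zero-class zero-class (cornerTwist i) (λ k j → place corner k (shift j (twist 2 i k))) (cornerTwist-twists i)
      flipWords : ∀ i → ∃[ w ] (ActsOn corners w id × Quiet w) × TwistsBy singles w (twist 1 i)
      flipWords i = concrete (singleFlip i) ,
        (acts₀ corner (singleFlip i) id (singleFlip-corner i) ,
         quiet (singleFlip i) (singleFlip-balanced i)) ,
        run-orbit single 0 0 nothing nothing outer-class zero-class zero-class (singleFlip i) (λ k j → place single k (shift j (twist 1 i k))) (singleFlip-flips i)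

      stage₁ : ∃[ w ] Assembled w × Balance w
      stage₁ = finish slices start
        where
          finish₂ : ∀ {u v} {π : Permutation′ 8} {π′ : Permutation′ 12} →
            ActsOn corners u id × ActsOn singles u id → ActsOn corners v (π ⟨$⟩ʳ_) → ActsOn singles v (π′ ⟨$⟩ʳ_) →
            Balance (u ++ v) →
            ∃[ a ] (ActsOn singles a id × Quiet a) × ActsOn corners a (quotient σ π) →
            ∃[ b ] (ActsOn corners b id × Quiet b) × ActsOn singles b (quotient τs π′) →
            ∃[ d ] (ActsOn singles d id × Quiet d) × TwistsBy corners d (toℕ ∘ x) →
            ∃[ e ] (ActsOn corners e id × Quiet e) × TwistsBy singles e (toℕ ∘ z) →
            ∃[ w ] Assembled w × Balance w
          finish₂ {u} {v} {π} {π′} (uc , us) vc vs bal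
            (a , (as , aq) , ac) (b , (bc , bq) , bs) (d , (ds , dq) , dt) (e , (ec , eq) , et) =
            -- Permutations come before twists because `x` and `z` are indexed by the position
            -- reached.
            ((((u ++ v) ++ a) ++ b) ++ d) ++ e ,
            (onCorners , onSingles) ,
            Balance-++ ((((u ++ v) ++ a) ++ b) ++ d) (Balance-++ (((u ++ v) ++ a) ++ b)
              (Balance-++ ((u ++ v) ++ a) (Balance-++ (u ++ v) bal aq) bq) dq) eq
            where
              onCorners : ∀ k j → run (((((u ++ v) ++ a) ++ b) ++ d) ++ e) (corners k j) ≡
                          corners (σ ⟨$⟩ʳ k) (shift j (toℕ (x (σ ⟨$⟩ʳ k))))
              onCorners k j =
                run-⨾ ((((u ++ v) ++ a) ++ b) ++ d) e {g = corners (σ ⟨$⟩ʳ k) (shift j (toℕ (x (σ ⟨$⟩ʳ k))))}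
                  (run-⨾ (((u ++ v) ++ a) ++ b) d {g = corners (σ ⟨$⟩ʳ k) j}
                    (run-⨾ ((u ++ v) ++ a) b {g = corners (σ ⟨$⟩ʳ k) j}
                      (run-⨾ (u ++ v) a {g = corners (π ⟨$⟩ʳ k) j} (run-⨾ u v {g = corners k j} (uc k j) (vc k j))
                        (trans (ac (π ⟨$⟩ʳ k) j) (cong (λ i → corners i j) (quotient-∘ σ π k))))
                      (bc (σ ⟨$⟩ʳ k) j))
                    (dt (σ ⟨$⟩ʳ k) j))
                  (ec (σ ⟨$⟩ʳ k) (shift j (toℕ (x (σ ⟨$⟩ʳ k)))))
              onSingles : ∀ k j → run (((((u ++ v) ++ a) ++ b) ++ d) ++ e) (singles k j) ≡
                          singles (τs ⟨$⟩ʳ k) (shift j (toℕ (z (τs ⟨$⟩ʳ k))))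
              onSingles k j =
                run-⨾ ((((u ++ v) ++ a) ++ b) ++ d) e {g = singles (τs ⟨$⟩ʳ k) j}
                  (run-⨾ (((u ++ v) ++ a) ++ b) d {g = singles (τs ⟨$⟩ʳ k) j}
                    (run-⨾ ((u ++ v) ++ a) b {g = singles (π′ ⟨$⟩ʳ k) j}
                      (run-⨾ (u ++ v) a {g = singles (π′ ⟨$⟩ʳ k) j} (run-⨾ u v {g = singles k j} (us k j) (vs k j))
                        (as (π′ ⟨$⟩ʳ k) j))
                      (trans (bs (π′ ⟨$⟩ʳ k) j) (cong (λ i → singles i j) (quotient-∘ τs π′ k))))
                    (ds (τs ⟨$⟩ʳ k) j))
                  (et (τs ⟨$⟩ʳ k) j)
          finish : (∃[ w ] ((ActsOn corners w id × ActsOn singles w id) × turns (suc m) w ≡ + 1) ×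
                           (∀ o → turns (δ o) w ≡ sgn (τc o))) →
                   ∃[ w ] Start w → ∃[ w ] Assembled w × Balance w
          finish (u , (uf , uH) , uδ) (v , (π , vc , eπ) , (π′ , vs , eπ′) , vH , vδ) =
            finish₂ {u} {v} {π} {π′} uf vc vs
              (trans (turns-++ (suc m) u v) (trans (cong₂ ℤ._*_ uH vH) (ℤₚ.*-identityˡ _)) ,
               λ o → trans (turns-++ (δ o) u v) (trans (cong₂ ℤ._*_ (uδ o) (vδ o)) (ℤₚ.*-identityʳ _)))
              (generate cornerClosed corners cornerWords (quotient σ π) (quotient-injective σ π)
                (quotient-even σ π (sym eπ)))
              (generate singleClosed singles singleWords (quotient τs π′) (quotient-injective τs π′)
                (quotient-even τs π′ (trans (sym (proj₁ cond₁)) (sym eπ′))))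
              (generateTwists cornerClosed corners twistWords (toℕ ∘ x)
                (trans (sym (toℕ-fromℕ< (m%n<n (sumFin (toℕ ∘ x)) 3))) (cong toℕ cond₃)))
              (generateTwists singleClosed singles flipWords (toℕ ∘ z)
                (trans (sym (toℕ-fromℕ< (m%n<n (sumFin (toℕ ∘ z)) 2))) (cong toℕ cond₄)))

    stage₂ : ∀ ms → Balance ms → ∃[ w ] Base₁ w × (∀ o → ActsOn (coupleds o) (ms ++ w) (τc o ⟨$⟩ʳ_))
    stage₂ ms bal =
      let w , base , done = settle closed₁ Fin._≟_ coupleds τc ms (allFin m) (λ {o} _ → current o) (λ {o} _ → cycles o)
      in w , base , λ o → done (∈-allFin o)
      where
        current : ∀ o → ∃[ π ] ActsOn (coupleds o) ms (π ⟨$⟩ʳ_) × sgn π ≡ sgn (τc o)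
        current o = let π , p , e = currentPermutation coupled (δ≤m o) z≤n (δ≢0 o) coupled-move ms in
          π , p , trans e (trans (movesParity-coupled (δ o) 0 ms) (proj₂ bal o))
        cycles : ∀ o i → ∃[ w ] Base₁ w × ActsOn (coupleds o) w (cycle i) ×
                 (∀ o′ → o′ ≢ o → ActsOn (coupleds o′) w id)
        cycles o i = concrete w ,
            ((acts₀ corner w id (coupledCycle-corner i) ,
              acts₀ single w id (coupledCycle-single i)) ,
             quiet w (coupledCycle-balanced i)) ,
            acts coupled (δ o) 0 (just 1F) nothing (layer-class 1F) zero-class w (cycle i) (coupledCycle-permutes i) ,
            λ o′ o′≢o → acts coupled (δ o′) 0 nothing nothing (other-class o′ o′≢o) zero-class w id (coupledCycle-coupled i)
          where
            open Inner o
            w = coupledCycle i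

    middle≢ : ∀ (o : Fin m) → toℕ (fromℕ m) ≢ toℕ o
    middle≢ o e = ℕₚ.<⇒≢ (toℕ<n o) (trans (sym e) (toℕ-fromℕ m))

    sgnτ-middle : sgnτ c (fromℕ m) ≡ + 1
    sgnτ-middle with toℕ (fromℕ m) ℕ.<? m
    ... | yes p = contradiction p (ℕₚ.≤⇒≯ (ℕₚ.≤-reflexive (sym (toℕ-fromℕ m))))
    ... | no  _ = refl

    -- On the middle lines the second distance is 0, where no move turns a slice: `turns 0` is 1, in
    -- accordance with the convention for `sgnτ` in (2).
    stage₃ : ∀ ms → Balance ms → ∃[ w ] Base₂ w ×
             (∀ o → ActsOn (pluses o) (ms ++ w) (ρe o (fromℕ m) (middle≢ o) ⟨$⟩ʳ_))
    stage₃ ms bal =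
      let w , base , done = settle closed₂ Fin._≟_ pluses (λ o → ρe o (fromℕ m) (middle≢ o)) ms (allFin m)
                              (λ {o} _ → current o) (λ {o} _ → cycles o)
      in w , base , λ o → done (∈-allFin o)
      where
        current : ∀ o → ∃[ π ] ActsOn (pluses o) ms (π ⟨$⟩ʳ_) × sgn π ≡ sgn (ρe o (fromℕ m) (middle≢ o))
        current o = let π , p , e = currentPermutation eCentre (δ≤m o) z≤n (δ≢0 o) eCentre-move ms in
          π , p , trans e (trans (movesParity-eCentre (δ o) 0 ms)
          (trans (cong₂ ℤ._*_ (cong₂ ℤ._*_ (proj₁ bal) (proj₂ bal o)) (trans (turns-0 ms) (sym sgnτ-middle)))
            (sym (cond₂ o (fromℕ m) (middle≢ o)))))
        cycles : ∀ o i → ∃[ w ] Base₂ w × ActsOn (pluses o) w (cycle i) ×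
                 (∀ o′ → o′ ≢ o → ActsOn (pluses o′) w id)
        cycles o i = concrete w ,
            (((acts₀ corner w id (plusCycle-corner i) ,
               acts₀ single w id (plusCycle-single i)) ,
              quiet w (plusCycle-balanced i)) ,
             λ o′ → let l , h , _ = inner-class (δ≤m o′) in acts coupled (δ o′) 0 (inner l) nothing h zero-class w id (plusCycle-coupled i l)) ,
            acts eCentre (δ o) 0 (just 1F) nothing (layer-class 1F) zero-class w (cycle i) (plusCycle-permutes i) ,
            λ o′ o′≢o → acts eCentre (δ o′) 0 nothing nothing (other-class o′ o′≢o) zero-class w id (plusCycle-plus i)
          where
            open Inner o
            w = plusCycle i

    stage₄ : ∀ ms → Balance ms → ∃[ w ] Base₃ w × (∀ o → ActsOn (crosses o) (ms ++ w) (ρc o ⟨$⟩ʳ_))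
    stage₄ ms bal =
      let w , base , done = settle closed₃ Fin._≟_ crosses ρc ms (allFin m) (λ {o} _ → current o) (λ {o} _ → cycles o)
      in w , base , λ o → done (∈-allFin o)
      where
        current : ∀ o → ∃[ π ] ActsOn (crosses o) ms (π ⟨$⟩ʳ_) × sgn π ≡ sgn (ρc o)
        current o = let π , p , e = currentPermutation cCentre (δ≤m o) z≤n (δ≢0 o) cCentre-move ms in
          π , p , trans e (trans (movesParity-cCentre (δ o) 0 ms)
          (trans (proj₁ bal) (sym (proj₂ cond₁ o))))
        cycles : ∀ o i → ∃[ w ] Base₃ w × ActsOn (crosses o) w (cycle i) ×
                 (∀ o′ → o′ ≢ o → ActsOn (crosses o′) w id)
        cycles o i = concrete w ,
            ((((acts₀ corner w id (cCentreCycle-corner i) ,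
                acts₀ single w id (cCentreCycle-single i)) ,
               quiet w (cCentreCycle-balanced i)) ,
              (λ o′ → let l , h , _ = inner-class (δ≤m o′) in acts coupled (δ o′) 0 (inner l) nothing h zero-class w id (cCentreCycle-coupled i l))) ,
             λ o′ → let l , h , _ = inner-class (δ≤m o′) in acts eCentre (δ o′) 0 (inner l) nothing h zero-class w id (cCentreCycle-plus i l)) ,
            acts cCentre (δ o) 0 (just 1F) nothing (layer-class 1F) zero-class w (cycle i) (cCentreCycle-permutes i) ,
            λ o′ o′≢o → acts cCentre (δ o′) 0 nothing nothing (other-class o′ o′≢o) zero-class w id (cCentreCycle-cCentre i)
          where
            open Inner o
            w = cCentreCycle i

    -- `settle` takes a target for every pair of indices, whereas `ρe` exists only off the diagonal;
    -- the identity fills the diagonal, which `indices` leaves out.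
    choose : ∀ o b → Dec (toℕ b ≡ toℕ o) → Permutation′ 24
    choose o b (yes _) = idₚ
    choose o b (no ne) = ρe o b ne

    -- Proofs of an inequality are definitionally equal, so ρe cannot depend on them.
    choose-ρe : ∀ o b (ne : toℕ b ≢ toℕ o) d → choose o b d ≡ ρe o b ne
    choose-ρe o b ne (yes e) = contradiction e ne
    choose-ρe o b ne (no _)  = refl

    target : Fin m × Fin (suc m) → Permutation′ 24
    target (o , b) = choose o b (toℕ b ℕ.≟ toℕ o)

    target-ρe : ∀ o b (ne : toℕ b ≢ toℕ o) → target (o , b) ≡ ρe o b ne
    target-ρe o b ne = choose-ρe o b ne (toℕ b ℕ.≟ toℕ o)

    sgnτ-inner : ∀ b (b<m : toℕ b < m) {s} → sgn (τc (fromℕ< b<m)) ≡ s → sgnτ c b ≡ s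
    sgnτ-inner b b<m h with toℕ b ℕ.<? m
    ... | yes _  = h
    ... | no  b≮ = contradiction b<m b≮

    -- The value `toℕ b = m` is excluded: it stands for the middle lines, settled in `stage₃`.
    oblique? : (i : Fin m × Fin (suc m)) → Dec (toℕ (proj₂ i) ≢ toℕ (proj₁ i) × toℕ (proj₂ i) < m)
    oblique? (o , b) = ¬? (toℕ b ℕ.≟ toℕ o) ×-dec (toℕ b ℕ.<? m)

    indices : List (Fin m × Fin (suc m))
    indices = filter oblique? (cartesianProduct (allFin m) (allFin (suc m)))

    stage₅ : ∀ ms → Balance ms → ∃[ w ] Base₄ w ×
             (∀ o b (ne : toℕ b ≢ toℕ o) → toℕ b < m → ActsOn (obliques (o , b)) (ms ++ w) (ρe o b ne ⟨$⟩ʳ_))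
    stage₅ ms bal =
      let w , base , done = settle closed₄ (≡-dec Fin._≟_ Fin._≟_) obliques target ms indices
            (λ {i} i∈ → let ne , b<m = oblique i∈ in current (proj₁ i) (proj₂ i) ne b<m)
            (λ {i} i∈ → let ne , b<m = oblique i∈ in cycles (proj₁ i) (proj₂ i) ne b<m)
      in w , base , λ o b ne b<m → subst (λ π → ActsOn (obliques (o , b)) (ms ++ w) (π ⟨$⟩ʳ_)) (target-ρe o b ne)
           (done (∈-filter⁺ oblique? (∈-cartesianProduct⁺ (∈-allFin o) (∈-allFin b)) (ne , b<m)))
      where
        oblique : ∀ {i} → i ∈ indices → toℕ (proj₂ i) ≢ toℕ (proj₁ i) × toℕ (proj₂ i) < m
        oblique i∈ = proj₂ (∈-filter⁻ oblique? {xs = cartesianProduct (allFin m) (allFin (suc m))} i∈)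
        δ-cancel : ∀ {k l} (a : Fin k) (b : Fin l) → toℕ a ≤ m → toℕ b ≤ m → δ a ≡ δ b → toℕ a ≡ toℕ b
        δ-cancel a b a≤m b≤m e = ℕₚ.∸-cancelˡ-≡ a≤m b≤m e
        current : ∀ o b → toℕ b ≢ toℕ o → toℕ b < m →
          ∃[ π ] ActsOn (obliques (o , b)) ms (π ⟨$⟩ʳ_) × sgn π ≡ sgn (target (o , b))
        current o b ne b<m =
          let π , p , e = currentPermutation eCentre (δ≤m o) (δ≤m b)
                (λ h → ne (sym (δ-cancel o b (ℕₚ.<⇒≤ (toℕ<n o)) (ℕₚ.<⇒≤ b<m) h))) eCentre-move ms in
          π , p , trans e (trans (movesParity-eCentre (δ o) (δ b) ms)
            (trans (cong₂ ℤ._*_ (cong₂ ℤ._*_ (proj₁ bal) (proj₂ bal o)) turns-b)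
              (trans (sym (cond₂ o b ne)) (cong sgn (sym (target-ρe o b ne))))))
          where
            turns-b : turns (δ b) ms ≡ sgnτ c b
            turns-b = sym (sgnτ-inner b b<m (trans (sym (proj₂ bal (fromℕ< b<m)))
              (cong (λ k → turns (m ℕ.∸ k) ms) (toℕ-fromℕ< b<m))))
        cycles : ∀ o b → toℕ b ≢ toℕ o → toℕ b < m → ∀ i → ∃[ w ] Base₄ w ×
          ActsOn (obliques (o , b)) w (cycle i) × (∀ i′ → i′ ≢ (o , b) → ActsOn (obliques i′) w id)
        cycles o b ne b<m i = concrete w ,
            (((((acts₀ corner w id (eCentreCycle-corner i) ,
                 acts₀ single w id (eCentreCycle-single i)) ,
                quiet w (eCentreCycle-balanced i)) ,
               (λ o′ → let l , h , _ = inner-class (δ≤m o′) in acts coupled (δ o′) 0 (inner l) nothing h zero-class w id (eCentreCycle-coupled i l))) ,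
              (λ o′ → let l , h , _ = inner-class (δ≤m o′) in
                acts eCentre (δ o′) 0 (inner l) nothing h zero-class w id (eCentreCycle-eCentre i l 0F λ { (_ , ()) }))) ,
             λ o′ → let l , h , _ = inner-class (δ≤m o′) in acts cCentre (δ o′) 0 (inner l) nothing h zero-class w id (eCentreCycle-cCentre i l)) ,
            acts eCentre (δ o) (δ b) (just 1F) (just 2F) (layer-class 1F) b-class w (cycle i) (eCentreCycle-permutes i) , others
          where
            b′ : Fin m
            b′ = fromℕ< b<m
            o≢b′ : o ≢ b′
            o≢b′ e = ne (trans (sym (toℕ-fromℕ< b<m)) (cong toℕ (sym e)))
            open Double o≢b′
            w = eCentreCycle i
            b-class : HasClass (δ b) (just 2F)
            b-class = subst (λ k → HasClass (m ℕ.∸ k) (just 2F)) (toℕ-fromℕ< b<m) (layer-class 2F)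
            others : ∀ i′ → i′ ≢ (o , b) → ActsOn (obliques i′) (concrete w) id
            others (o′ , b″) ≢ob =
              -- Classes 1 and 2 together would identify the distances as `δ o` and `δ b`, hence the
              -- orbit as (o , b) itself; every other pair of classes has been checked.
              let l , h , e = inner-class (δ≤m o′) ; l′ , h′ , e′ = inner-class (δ≤m b″) in
              acts eCentre (δ o′) (δ b″) (inner l) (inner l′) h h′ w id (eCentreCycle-eCentre i l l′ λ (p , q) → ≢ob (cong₂ _,_
                (δ-injective (e p))
                (toℕ-injective (trans (δ-cancel b″ b′ (toℕ≤pred[n] b″) (ℕₚ.<⇒≤ (toℕ<n b′)) (e′ q)) (toℕ-fromℕ< b<m)))))

    retain : ∀ {J} (φ : Fin m → Fin 24 → Fin J → Facelet) (f : Fin m → Fin 24 → Fin 24) u v →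
             (∀ o → ActsOn (φ o) u (f o)) → (∀ o → ActsOn (φ o) v id) → ∀ o → ActsOn (φ o) (u ++ v) (f o)
    retain φ f u v p q o = ActsOn-++ (φ o) u {v} {f o} {id} (p o) (q o)

    realize : Cond5 c → Valid c
    realize cond₅ = finish₁ stage₁
      where
        finish₅ : ∀ ms → Assembled ms → (∀ o → ActsOn (coupleds o) ms (τc o ⟨$⟩ʳ_)) →
          (∀ o → ActsOn (pluses o) ms (ρe o (fromℕ m) (middle≢ o) ⟨$⟩ʳ_)) →
          (∀ o → ActsOn (crosses o) ms (ρc o ⟨$⟩ʳ_)) →
          (∀ o b (ne : toℕ b ≢ toℕ o) → toℕ b < m → ActsOn (obliques (o , b)) ms (ρe o b ne ⟨$⟩ʳ_)) →
          Realizes c (run ms)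
        finish₅ ms (cs , ss) co pl cr ob = record
          { corners  = λ k j → transport (corner-orbit k j) (corner-orbit (σ ⟨$⟩ʳ k) (shift j (toℕ (x (σ ⟨$⟩ʳ k))))) (cs k j)
          ; singles  = λ k j → transport (single-orbit k j) (single-orbit (τs ⟨$⟩ʳ k) (shift j (toℕ (z (τs ⟨$⟩ʳ k))))) (ss k j)
          -- The sticker index `j`, its handedness, has been kept throughout, which is the shift by
          -- 0 that (5) prescribes.
          ; coupled  = λ o k j → trans (transport (coupled-orbit o k j) (coupled-orbit o (τc o ⟨$⟩ʳ k) j) (co o k j))
              (cong (coupledF o (τc o ⟨$⟩ʳ k))
                (sym (trans (cong (λ t → j ⊕[ 2 ] t) (cond₅ o (τc o ⟨$⟩ʳ k))) (shift-0 j))))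
          ; cCentres = λ o k → transport (cCentre-orbit o k) (cCentre-orbit o (ρc o ⟨$⟩ʳ k)) (cr o k 0F)
          ; eCentres = λ o b ne k → edges o b ne k (toℕ b ℕ.<? m)
          ; fCentres = run-faceCentre ms
          }
          where
            transport : ∀ {f f′ g g′} → f ≡ f′ → g ≡ g′ → run ms f′ ≡ g′ → run ms f ≡ g
            transport refl refl e = e
            edges : ∀ o b (ne : toℕ b ≢ toℕ o) k → Dec (toℕ b < m) →
              run ms (edgeCentreF o b k) ≡ edgeCentreF o b (ρe o b ne ⟨$⟩ʳ k)
            edges o b ne k (yes b<m) =
              transport (eCentre-orbit o b k) (eCentre-orbit o b (ρe o b ne ⟨$⟩ʳ k)) (ob o b ne b<m k 0F)
            -- Only `toℕ b = m` is left; there `δ b` is 0 and the orbit is one of the `pluses`.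
            edges o b ne k (no b≮m) = middle b (toℕ-injective (trans
                (ℕₚ.≤-antisym (toℕ≤pred[n] b) (ℕₚ.≮⇒≥ b≮m)) (sym (toℕ-fromℕ m)))) ne
              where
                δ-middle : δ (fromℕ m) ≡ 0
                δ-middle = trans (cong (m ℕ.∸_) (toℕ-fromℕ m)) (ℕₚ.n∸n≡0 m)
                plus-orbit : ∀ k → edgeCentreF o (fromℕ m) k ≡ pluses o k 0F
                plus-orbit k = trans (eCentre-orbit o (fromℕ m) k) (cong (λ y → orbit eCentre (δ o) y k 0F) δ-middle)
                middle : ∀ b → b ≡ fromℕ m → (ne : toℕ b ≢ toℕ o) →
                  run ms (edgeCentreF o b k) ≡ edgeCentreF o b (ρe o b ne ⟨$⟩ʳ k)
                middle _ refl ne = transport (plus-orbit k) (plus-orbit (ρe o (fromℕ m) ne ⟨$⟩ʳ k)) (pl o k 0F)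
        finish₄ : ∀ ms → Assembled ms → Balance ms → (∀ o → ActsOn (coupleds o) ms (τc o ⟨$⟩ʳ_)) →
          (∀ o → ActsOn (pluses o) ms (ρe o (fromℕ m) (middle≢ o) ⟨$⟩ʳ_)) →
          (∀ o → ActsOn (crosses o) ms (ρc o ⟨$⟩ʳ_)) → Valid c
        finish₄ ms as bal co pl cr =
          let w , ((((fx , q) , fco) , fpl) , fcr) , ob = stage₅ ms bal in
          ms ++ w , finish₅ (ms ++ w) (Assembled-++ ms as fx)
            (retain coupleds (λ o → τc o ⟨$⟩ʳ_) ms w co fco) (retain pluses (λ o → ρe o (fromℕ m) (middle≢ o) ⟨$⟩ʳ_) ms w pl fpl)
            (retain crosses (λ o → ρc o ⟨$⟩ʳ_) ms w cr fcr) ob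
        finish₃ : ∀ ms → Assembled ms → Balance ms → (∀ o → ActsOn (coupleds o) ms (τc o ⟨$⟩ʳ_)) →
          (∀ o → ActsOn (pluses o) ms (ρe o (fromℕ m) (middle≢ o) ⟨$⟩ʳ_)) → Valid c
        finish₃ ms as bal co pl =
          let w , (((fx , q) , fco) , fpl) , cr = stage₄ ms bal in
          finish₄ (ms ++ w) (Assembled-++ ms as fx) (Balance-++ ms bal q)
            (retain coupleds (λ o → τc o ⟨$⟩ʳ_) ms w co fco) (retain pluses (λ o → ρe o (fromℕ m) (middle≢ o) ⟨$⟩ʳ_) ms w pl fpl) cr
        finish₂ : ∀ ms → Assembled ms → Balance ms → (∀ o → ActsOn (coupleds o) ms (τc o ⟨$⟩ʳ_)) → Valid c
        finish₂ ms as bal co =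
          let w , ((fx , q) , fco) , pl = stage₃ ms bal in
          finish₃ (ms ++ w) (Assembled-++ ms as fx) (Balance-++ ms bal q)
            (retain coupleds (λ o → τc o ⟨$⟩ʳ_) ms w co fco) pl
        finish₁ : ∃[ w ] Assembled w × Balance w → Valid c
        finish₁ (ms , as , bal) =
          let w , (fx , q) , co = stage₂ ms bal in
          finish₂ (ms ++ w) (Assembled-++ ms as fx) (Balance-++ ms bal q) co

theorem17 : (m : ℕ) → (c : Cube.Conf m) →
    Cube.Cond1 m c → Cube.Cond2 m c → Cube.Cond3 m c → Cube.Cond4 m c →
    Cube.Cond5 m c → Cube.Valid m c
theorem17 m c c₁ c₂ c₃ c₄ = Solve.realize m c c₁ c₂ c₃ c₄
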